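{- For all $n\ge1$ and all $\sigma\in S_n(321)$, $\mathrm{crs}(\Theta(\sigma))=\mathrm{crs}(\sigma)$.
   Context: $S_n(\tau)$: permutations of $[n]$ avoiding the pattern $\tau$. A crossing of $\sigma$ is a pair $(i,j)$ with $i<j<\sigma(i)<\sigma(j)$ or $\sigma(i)<\sigma(j)\le i<j$; $\mathrm{crs}(\sigma)$ is their number. Definition of $\Theta$ (Elizalde–Pak bijection $S_n(321)\to S_n(132)$): for $\sigma\in S_n(321)$ let $(P,Q)$ be the insertion and recording tableaux of the Robinson–Schensted (RSK) correspondence applied to $\sigma$ (at most two rows). $\Psi(\sigma)$ is the path of $2n$ steps $u=(1,1)$, $d=(1,-1)$ whose first $n$ steps are, for $i=1,\dots,n$, $u$ if $i$ is in the first row of $P$ and $d$ if in the second, and whose last $n$ steps are, for $j=n,\dots,1$, $u$ if $j$ is in the second row of $Q$ and $d$ if in the first; it is a Dyck path. In a Dyck path each up-step is matched with the first later down-step ending at the height where the up-step starts. Labelling up-steps left to right $n,\dots,1$ and down-steps left to right $1,\dots,n$, $\Phi^{ -1}(D)$ is the permutation sending each up-step label to the label of its matched down-step; it is a bijection from Dyck paths of semilength $n$ onto $S_n(132)$. $\Theta=\Phi^{ -1}\circ\Psi$. -}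

module Defs where

open import Data.Bool using (Bool; true; false; if_then_else_; _∧_; _∨_; not)
open import Data.Nat using (ℕ; zero; suc; _+_; _∸_; _<_; _≤_; _<ᵇ_; _≤ᵇ_; _≡ᵇ_)
open import Data.Integer as ℤ using (ℤ; +_)
open import Data.List using (List; []; _∷_; _++_; map; length; upTo; reverse; take; filterᵇ; findᵇ)
open import Data.Bool.ListAction using (any)
open import Data.Maybe using (Maybe; just; nothing)
open import Data.Product using (_×_; _,_; proj₁; proj₂)
open import Data.Empty using (⊥)
open import Relation.Nullary using (¬_; does)
open import Data.List.Relation.Binary.Permutation.Propositional using (_↭_)

-- Permutations in one-line notation.
-- A permutation σ of [n] = {1,…,n} is the list [σ(1), …, σ(n)] of naturals.

nth : {A : Set} → A → List A → ℕ → A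
nth d []       _       = d
nth d (x ∷ xs) zero    = x
nth d (x ∷ xs) (suc k) = nth d xs k

oneTo : ℕ → List ℕ
oneTo n = map suc (upTo n)

-- σ(i) for 1 ≤ i ≤ n (one-line notation, 1-indexed)
app : List ℕ → ℕ → ℕ
app σ i = nth 0 σ (i ∸ 1)

IsPerm : ℕ → List ℕ → Set
IsPerm n σ = σ ↭ oneTo n

Avoids321 : List ℕ → Set
Avoids321 σ = (i j k : ℕ) → i < j → j < k → k < length σ →
  ¬ ((nth 0 σ j < nth 0 σ i) × (nth 0 σ k < nth 0 σ j))

InS321 : ℕ → List ℕ → Set
InS321 n σ = IsPerm n σ × Avoids321 σ

isCrossing : List ℕ → ℕ → ℕ → Bool
isCrossing σ i j =
  ((i <ᵇ j) ∧ (j <ᵇ app σ i) ∧ (app σ i <ᵇ app σ j))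
  ∨ ((app σ i <ᵇ app σ j) ∧ (app σ j ≤ᵇ i) ∧ (i <ᵇ j))

pairs : ℕ → List (ℕ × ℕ)
pairs n = Data.List.concatMap (λ i → map (λ j → (i , j)) (oneTo n)) (oneTo n)
  where import Data.List

crs : ℕ → List ℕ → ℕ
crs n σ = length (filterᵇ (λ p → isCrossing σ (proj₁ p) (proj₂ p)) (pairs n))

-- Robinson–Schensted (row insertion). Tableaux are lists of rows,
-- the first row first.

Tableau : Set
Tableau = List (List ℕ)

rowIns : ℕ → List ℕ → Maybe ℕ × List ℕ
rowIns x []       = nothing , x ∷ []
rowIns x (y ∷ ys) with x <ᵇ y
... | true  = just y , x ∷ ys
... | false = proj₁ r , y ∷ proj₂ r
  where r = rowIns x ys

-- insert x into a tableau; also return the (0-based) index of the row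
-- in which the new cell was created
ins : ℕ → Tableau → Tableau × ℕ
ins x []       = (x ∷ []) ∷ [] , 0
ins x (r ∷ rs) with rowIns x r
... | nothing , r' = r' ∷ rs , 0
... | just y  , r' = r' ∷ proj₁ t , suc (proj₂ t)
  where t = ins y rs

addAt : ℕ → ℕ → Tableau → Tableau
addAt v zero    []       = (v ∷ []) ∷ []
addAt v zero    (r ∷ rs) = (r ++ v ∷ []) ∷ rs
addAt v (suc k) []       = [] ∷ addAt v k []
addAt v (suc k) (r ∷ rs) = r ∷ addAt v k rs

rskGo : ℕ → List ℕ → Tableau × Tableau → Tableau × Tableau
rskGo t []       pq = pq
rskGo t (x ∷ xs) (P , Q) =
  rskGo (suc t) xs (proj₁ ins' , addAt t (proj₂ ins') Q)
  where ins' = ins x P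

RSK : List ℕ → Tableau × Tableau
RSK σ = rskGo 1 σ ([] , [])

row : ℕ → Tableau → List ℕ
row k T = nth [] T k

_∈ᵇ_ : ℕ → List ℕ → Bool
x ∈ᵇ xs = any (λ y → x ≡ᵇ y) xs

-- Lattice paths: true = u = (1,1), false = d = (1,-1).

Path : Set
Path = List Bool

-- Ψ(σ): first n steps, i = 1..n: u iff i is in the first row of P
-- (otherwise i is in the second row: d);
-- last n steps, j = n..1: u iff j is in the second row of Q
-- (otherwise j is in the first row: d).
Ψ : ℕ → List ℕ → Path
Ψ n σ =
  map (λ i → i ∈ᵇ row 0 (proj₁ (RSK σ))) (oneTo n)
  ++ map (λ j → j ∈ᵇ row 1 (proj₂ (RSK σ))) (reverse (oneTo n))

countUp : Path → ℕ
countUp D = length (filterᵇ (λ b → b) D)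

countDown : Path → ℕ
countDown D = length (filterᵇ not D)

height : Path → ℕ → ℤ
height D k = (+ countUp (take k D)) ℤ.- (+ countDown (take k D))

step : Path → ℕ → Bool
step D p = nth false D p

matchOf : Path → ℕ → ℕ
matchOf D p with findᵇ (λ q → (p <ᵇ q) ∧ not (step D q)
                          ∧ does (height D (suc q) ℤ.≟ height D p))
                       (upTo (length D))
... | just q  = q
... | nothing = 0

upPositions : Path → List ℕ
upPositions D = filterᵇ (step D) (upTo (length D))

downLabel : Path → ℕ → ℕ
downLabel D q = suc (countDown (take q D))

-- Φ⁻¹(D): up-steps labelled n,…,1 left to right; the up-step labelled i
-- is the (n − i)-th (0-based) up-step. σ(i) = label of its matched down-step.
Φinv : ℕ → Path → List ℕ
Φinv n D = map (λ i → downLabel D (matchOf D (nth 0 (upPositions D) (n ∸ i)))) (oneTo n)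

-- Elizalde–Pak bijection Θ = Φ⁻¹ ∘ Ψ : S_n(321) → S_n(132)
Θ : ℕ → List ℕ → List ℕ
Θ n σ = Φinv n (Ψ n σ)

{-# OPTIONS --safe #-}
-- A 321-avoiding permutation is grown one value at a time, raising the earlier values that are ≥ the new one.
-- Appending the value m + 1 inserts a peak at position m of Ψ(σ): this is what row insertion does to the two
-- rows, because behind position m the first half of the path consists of down steps followed by up steps.
-- So the tunnels (matched pairs of steps) of Ψ(σ) can be followed through the construction, the centred ones
-- being the fixed points of σ.
-- In Φ⁻¹(D) two values can only cross if their tunnels are nested, and the number of tunnels crossing a given
-- one from inside depends only on its two endpoints; summing over the tunnels gives crs(Φ⁻¹(D)).
-- At each growth step this sum and crs(σ) increase by the same amount, n − m minus the number of fixed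
-- points > m.
module Submission where

open import Defs
open import Data.Bool using (Bool; true; false; not; _∧_)
open import Data.Bool.Properties using (∧-zeroʳ)
open import Data.Empty using (⊥; ⊥-elim)
import Data.Integer as ℤ
import Data.Integer.Properties as ℤ
open import Data.List using (List; []; _∷_; _++_; map; length; upTo; applyUpTo; concatMap; filterᵇ; findᵇ; take; replicate; reverse; initLast; _∷ʳ′_)
open import Data.List.Membership.Propositional.Properties using (∈-upTo⁻; ∈-map⁻; ∈-insert)
open import Data.List.Properties
open import Data.List.Relation.Binary.Permutation.Propositional using (_↭_; ↭-sym; ↭-reflexive) renaming (refl to ↭-refl; trans to ↭-trans; prep to ↭-prep; swap to ↭-swap)
open import Data.List.Relation.Binary.Permutation.Propositional.Properties using (map⁺; ↭-map-inv; drop-mid; ↭-empty-inv; ↭-length; ∈-resp-↭)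
open import Data.List.Relation.Unary.All using (All; []; _∷_) renaming (map to All-map)
import Data.List.Relation.Unary.All.Properties as All
open import Data.Maybe using (just; nothing) renaming (map to Maybe-map)
open import Data.Nat
open import Data.Nat.Properties
open import Data.Nat.Tactic.RingSolver using (solve-∀)
open import Data.Product using (_×_; _,_; proj₁; proj₂; ∃; ∃-syntax)
open import Data.Sum using (_⊎_; inj₁; inj₂)
open import Function using (_∘_)
open import Relation.Binary.Definitions using (tri<; tri≈; tri>)
open import Relation.Binary.PropositionalEquality hiding ([_])
open import Relation.Nullary using (¬_; Dec; yes; no; does)
open import Relation.Nullary.Decidable using (_×-dec_; _⊎-dec_; dec-true; dec-false)

-- Crossings of `σ` and of its image are not matched one by one; only the increments of the two
-- totals along a growth history are compared. The number n - m arises for different reasons on the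
-- two sides. For the permutation it counts the positions from m + 1 to n: each adds one crossing,
-- an upper one if it is an excedance, a lower one with the appended entry if its value is smaller
-- than the position, and only a fixed point adds none. For the path it counts the steps between the
-- new peak and the middle, charged to the tunnels they belong to, and only a centred tunnel that
-- starts behind the peak fails to profit. The number `B` turns 321-avoidance into an inequality:
-- the appended value must exceed it. It is also the length of the prefix of the path behind which
-- the first half is down steps followed by up steps. Bijections (of ranks, positions, values) are
-- stated as equalities of sums of an arbitrary function, a form that passes through the induction
-- by composition with `punch`.

-- A matched pair (p , p + 2ℓ + 1) of positions is encoded as (p , ℓ).
Tunnel : Set
Tunnel = ℕ × ℕ

private
  variable
    A : Set
    P Q R : Set
    a b c i j k m n p q t x y B B′ : ℕ
    f g : ℕ → ℕ
    ω : Bool → ℕ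
    D : Path
    τ : List ℕ
    Ts : List Tunnel

-- Finite sums and indicators

+-interchange : ∀ a b c d → (a + b) + (c + d) ≡ (a + c) + (b + d)
+-interchange = solve-∀

𝟙 : Bool → ℕ
𝟙 true  = 1
𝟙 false = 0

[_] : Dec P → ℕ
[ d ] = 𝟙 (does d)

χ-yes : (d : Dec P) → P → [ d ] ≡ 1
χ-yes (yes _) _ = refl
χ-yes (no ¬p) p = ⊥-elim (¬p p)

χ-no : (d : Dec P) → ¬ P → [ d ] ≡ 0
χ-no (yes p) ¬p = ⊥-elim (¬p p)
χ-no (no _)  _  = refl

χ-cong : (d : Dec P) (e : Dec Q) → (P → Q) → (Q → P) → [ d ] ≡ [ e ]
χ-cong (yes p) e f g = sym (χ-yes e (f p))
χ-cong (no ¬p) e f g = sym (χ-no e (¬p ∘ g))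

χ-disjoint : (d : Dec P) (e : Dec Q) (e′ : Dec R) → (P → Q ⊎ R) → (Q → P) → (R → P) → (Q → ¬ R) →
  [ d ] ≡ [ e ] + [ e′ ]
χ-disjoint (no ¬p) e e′ f g h _ = sym (cong₂ _+_ (χ-no e (¬p ∘ g)) (χ-no e′ (¬p ∘ h)))
χ-disjoint (yes p) e e′ f g h k with f p
... | inj₁ q = sym (cong₂ _+_ (χ-yes e q) (χ-no e′ (k q)))
... | inj₂ r = sym (cong₂ _+_ (χ-no e (λ q → k q r)) (χ-yes e′ r))

∑< : ℕ → (ℕ → ℕ) → ℕ
∑< zero    f = 0
∑< (suc n) f = ∑< n f + f n

∑<-cong : ∀ n → (∀ t → t < n → f t ≡ g t) → ∑< n f ≡ ∑< n g
∑<-cong zero    h = refl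
∑<-cong (suc n) h = cong₂ _+_ (∑<-cong n λ t t<n → h t (m<n⇒m<1+n t<n)) (h n ≤-refl)

∑<-+ : ∀ n → ∑< n (λ t → f t + g t) ≡ ∑< n f + ∑< n g
∑<-+ zero = refl
∑<-+ {f} {g} (suc n) rewrite ∑<-+ {f} {g} n = +-interchange (∑< n f) (∑< n g) (f n) (g n)

∑<-zero : ∀ n → (∀ t → t < n → f t ≡ 0) → ∑< n f ≡ 0
∑<-zero zero    h = refl
∑<-zero (suc n) h = cong₂ _+_ (∑<-zero n λ t t<n → h t (m<n⇒m<1+n t<n)) (h n ≤-refl)

∑<-swap : ∀ m n (f : ℕ → ℕ → ℕ) → ∑< m (λ i → ∑< n (f i)) ≡ ∑< n (λ j → ∑< m (λ i → f i j))
∑<-swap zero    n f = sym (∑<-zero n λ _ _ → refl)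
∑<-swap (suc m) n f = trans (cong (_+ ∑< n (f m)) (∑<-swap m n f)) (sym (∑<-+ n))

∑<-head : ∀ n (f : ℕ → ℕ) → ∑< (suc n) f ≡ f 0 + ∑< n (f ∘ suc)
∑<-head zero    f = +-comm 0 (f 0)
∑<-head (suc n) f = trans (cong (_+ f (suc n)) (∑<-head n f)) (+-assoc (f 0) _ _)

∑<-reverse : ∀ n (f : ℕ → ℕ) → ∑< n f ≡ ∑< n (λ t → f (n ∸ suc t))
∑<-reverse zero    f = refl
∑<-reverse (suc n) f = begin
  ∑< n f + f n                              ≡⟨ +-comm _ (f n) ⟩
  f n + ∑< n f                              ≡⟨ cong (f n +_) (∑<-reverse n f) ⟩
  f n + ∑< n (λ t → f (n ∸ suc t))          ≡⟨ ∑<-head n (λ t → f (n ∸ t)) ⟨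
  ∑< (suc n) (λ t → f (n ∸ t))              ∎
  where open ≡-Reasoning

∑<-interval : ∀ n → b ≤ n → ∑< n (λ t → [ (a ≤? t) ×-dec (t <? b) ]) ≡ b ∸ a
∑<-interval {b} {a} zero b≤0 rewrite n≤0⇒n≡0 b≤0 = sym (0∸n≡0 a)
∑<-interval {b} {a} (suc n) b≤1+n with m≤n⇒m<n∨m≡n b≤1+n
... | inj₁ (s≤s b≤n) = trans
  (cong₂ _+_ (∑<-interval {b} {a} n b≤n)
             (χ-no ((a ≤? n) ×-dec (n <? b)) λ (_ , n<b) → <⇒≱ n<b b≤n))
  (+-identityʳ _)
... | inj₂ refl = trans
  (cong (_+ [ (a ≤? n) ×-dec (n <? suc n) ]) (trans (∑<-cong n (λ t t<n →
     χ-cong ((a ≤? t) ×-dec (t <? suc n)) ((a ≤? t) ×-dec (t <? n))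
       (λ (h , _) → h , t<n) (λ (h , _) → h , m<n⇒m<1+n t<n))) (∑<-interval {n} {a} n ≤-refl)))
  last
  where
  last : (n ∸ a) + [ (a ≤? n) ×-dec (n <? suc n) ] ≡ suc n ∸ a
  last with ≤-<-connex a n
  ... | inj₁ a≤n = trans (cong (n ∸ a +_) (χ-yes ((a ≤? n) ×-dec (n <? suc n)) (a≤n , ≤-refl)))
                     (trans (+-comm (n ∸ a) 1) (sym (+-∸-assoc 1 a≤n)))
  ... | inj₂ n<a = trans (cong (n ∸ a +_) (χ-no ((a ≤? n) ×-dec (n <? suc n)) λ (h , _) → <⇒≱ n<a h))
                     (trans (+-identityʳ _) (trans (m≤n⇒m∸n≡0 (<⇒≤ n<a)) (sym (m≤n⇒m∸n≡0 n<a))))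

∑∈ : List A → (A → ℕ) → ℕ
∑∈ []       f = 0
∑∈ (x ∷ xs) f = f x + ∑∈ xs f

∑∈-cong : {f g : A → ℕ} {xs : List A} → All (λ x → f x ≡ g x) xs → ∑∈ xs f ≡ ∑∈ xs g
∑∈-cong []       = refl
∑∈-cong (e ∷ es) = cong₂ _+_ e (∑∈-cong es)

∑∈-map : {B : Set} {f : B → ℕ} {h : A → B} (xs : List A) → ∑∈ (map h xs) f ≡ ∑∈ xs (f ∘ h)
∑∈-map []       = refl
∑∈-map {f = f} {h} (x ∷ xs) = cong (f (h x) +_) (∑∈-map xs)

∑∈-+ : {f g : A → ℕ} (xs : List A) → ∑∈ xs (λ x → f x + g x) ≡ ∑∈ xs f + ∑∈ xs g
∑∈-+ [] = refl
∑∈-+ {f = f} {g} (x ∷ xs) = trans (cong (f x + g x +_) (∑∈-+ xs)) (+-interchange (f x) (g x) _ _)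

-- The increasing map whose image omits only `a`. It describes the raising of values, the
-- renumbering of up or down steps when a peak is inserted and, applied twice, the displacement of
-- path positions.
punch : ℕ → ℕ → ℕ
punch zero    t       = suc t
punch (suc a) zero    = zero
punch (suc a) (suc t) = suc (punch a t)

punch-< : t < a → punch a t ≡ t
punch-< {zero}  {suc a} _         = refl
punch-< {suc t} {suc a} (s≤s t<a) = cong suc (punch-< t<a)

punch-≥ : a ≤ t → punch a t ≡ suc t
punch-≥ {zero}          _         = refl
punch-≥ {suc a} {suc t} (s≤s a≤t) = cong suc (punch-≥ a≤t)

punch-mono-< : ∀ a → x < y → punch a x < punch a y
punch-mono-< zero                     x<y       = s≤s x<y
punch-mono-< {zero}  {suc y} (suc a)  x<y       = s≤s z≤n
punch-mono-< {suc x} {suc y} (suc a)  (s≤s x<y) = s≤s (punch-mono-< a x<y)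

punch-cancel-< : ∀ a → punch a x < punch a y → x < y
punch-cancel-< {x} {y} a h with <-≤-connex x y
... | inj₁ x<y = x<y
... | inj₂ y≤x with m≤n⇒m<n∨m≡n y≤x
...   | inj₁ y<x  = ⊥-elim (<-asym h (punch-mono-< a y<x))
...   | inj₂ refl = ⊥-elim (<-irrefl refl h)

∑<-punch : ∀ n (g : ℕ → ℕ) → a ≤ n → ∑< (suc n) g ≡ g a + ∑< n (g ∘ punch a)
∑<-punch {zero}  n       g _         = ∑<-head n g
∑<-punch {suc a} (suc n) g (s≤s a≤n) = begin
  ∑< (suc (suc n)) g                                    ≡⟨ ∑<-head (suc n) g ⟩
  g 0 + ∑< (suc n) (g ∘ suc)                            ≡⟨ cong (g 0 +_) (∑<-punch n (g ∘ suc) a≤n) ⟩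
  g 0 + (g (suc a) + ∑< n (g ∘ suc ∘ punch a))          ≡⟨ swap (g 0) (g (suc a)) _ ⟩
  g (suc a) + (g 0 + ∑< n (g ∘ suc ∘ punch a))          ≡⟨ cong (g (suc a) +_) (∑<-head n (g ∘ punch (suc a))) ⟨
  g (suc a) + ∑< (suc n) (g ∘ punch (suc a))            ∎
  where
  open ≡-Reasoning
  swap : ∀ x y z → x + (y + z) ≡ y + (x + z)
  swap = solve-∀

punch₂ : ℕ → ℕ → ℕ
punch₂ a t = punch a (punch a t)

punch₂-< : t < a → punch₂ a t ≡ t
punch₂-< {t} {a} t<a = trans (cong (punch a) (punch-< t<a)) (punch-< t<a)

punch₂-≥ : a ≤ t → punch₂ a t ≡ suc (suc t)
punch₂-≥ {a} {t} a≤t = trans (cong (punch a) (punch-≥ a≤t)) (punch-≥ (m≤n⇒m≤1+n a≤t))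

∑<-punch₂ : ∀ n (g : ℕ → ℕ) → a ≤ n →
  ∑< (suc (suc n)) g ≡ g a + g (suc a) + ∑< n (g ∘ punch₂ a)
∑<-punch₂ {a} n g a≤n = begin
  ∑< (suc (suc n)) g                                       ≡⟨ ∑<-punch (suc n) g (m≤n⇒m≤1+n a≤n) ⟩
  g a + ∑< (suc n) (g ∘ punch a)                           ≡⟨ cong (g a +_) (∑<-punch n (g ∘ punch a) a≤n) ⟩
  g a + (g (punch a a) + ∑< n (g ∘ punch₂ a))              ≡⟨ +-assoc (g a) _ _ ⟨
  g a + g (punch a a) + ∑< n (g ∘ punch₂ a)                ≡⟨ cong (λ z → g a + g z + ∑< n (g ∘ punch₂ a)) (punch-≥ ≤-refl) ⟩
  g a + g (suc a) + ∑< n (g ∘ punch₂ a)                    ∎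
  where open ≡-Reasoning

-- Lattice paths and their matched steps

insertPeak : ℕ → Path → Path
insertPeak (suc m) (c ∷ D) = c ∷ insertPeak m D
insertPeak _       D       = true ∷ false ∷ D

length-insertPeak : ∀ m D → length (insertPeak m D) ≡ suc (suc (length D))
length-insertPeak zero    D       = refl
length-insertPeak (suc m) []      = refl
length-insertPeak (suc m) (c ∷ D) = cong suc (length-insertPeak m D)

step-peak-up : ∀ m D → m ≤ length D → step (insertPeak m D) m ≡ true
step-peak-up zero    D       _         = refl
step-peak-up (suc m) (c ∷ D) (s≤s m≤n) = step-peak-up m D m≤n

step-peak-down : ∀ m D → m ≤ length D → step (insertPeak m D) (suc m) ≡ false
step-peak-down zero    D       _         = refl
step-peak-down (suc m) (c ∷ D) (s≤s m≤n) = step-peak-down m D m≤n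

step-insertPeak : ∀ m D t → m ≤ length D → step (insertPeak m D) (punch₂ m t) ≡ step D t
step-insertPeak zero    D       t       _         = refl
step-insertPeak (suc m) (c ∷ D) zero    (s≤s m≤n) = refl
step-insertPeak (suc m) (c ∷ D) (suc t) (s≤s m≤n) = step-insertPeak m D t m≤n

-- A general `ω` lets each fact about peak insertion be proved once for up steps and down steps.
weight : (Bool → ℕ) → Path → ℕ → ℕ
weight ω []      _       = 0
weight ω (c ∷ D) zero    = 0
weight ω (c ∷ D) (suc t) = ω c + weight ω D t

weight-zero : ∀ D → weight ω D 0 ≡ 0
weight-zero []      = refl
weight-zero (_ ∷ _) = refl

weight-suc : ∀ D → t < length D → weight ω D (suc t) ≡ weight ω D t + ω (step D t)
weight-suc {zero}  {ω} (c ∷ D) _ = trans (cong (ω c +_) (weight-zero D)) (+-comm (ω c) 0)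
weight-suc {suc t} {ω} (c ∷ D) (s≤s t<n) =
  trans (cong (ω c +_) (weight-suc D t<n)) (sym (+-assoc (ω c) _ _))

weight-mono : ∀ D → x ≤ y → weight ω D x ≤ weight ω D y
weight-mono         []      _         = z≤n
weight-mono         (c ∷ D) z≤n       = z≤n
weight-mono {ω = ω} (c ∷ D) (s≤s x≤y) = +-monoʳ-≤ (ω c) (weight-mono D x≤y)

weight-insertPeak-≤ : ∀ m D → m ≤ length D → t ≤ m →
  weight ω (insertPeak m D) t ≡ weight ω D t
weight-insertPeak-≤ zero D _ z≤n = sym (weight-zero D)
weight-insertPeak-≤ (suc m) (c ∷ D) (s≤s m≤n) z≤n = refl
weight-insertPeak-≤ {ω = ω} (suc m) (c ∷ D) (s≤s m≤n) (s≤s t≤m) =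
  cong (ω c +_) (weight-insertPeak-≤ m D m≤n t≤m)

weight-insertPeak-mid : ∀ m D → m ≤ length D →
  weight ω (insertPeak m D) (suc m) ≡ ω true + weight ω D m
weight-insertPeak-mid {ω} zero D _ = cong (ω true +_) (sym (weight-zero D))
weight-insertPeak-mid {ω} (suc m) (c ∷ D) (s≤s m≤n) =
  trans (cong (ω c +_) (weight-insertPeak-mid m D m≤n)) (swap (ω c) (ω true) _)
  where
  swap : ∀ x y z → x + (y + z) ≡ y + (x + z)
  swap = solve-∀

weight-insertPeak-≥ : ∀ m D → m ≤ length D → m ≤ t →
  weight ω (insertPeak m D) (2 + t) ≡ ω true + ω false + weight ω D t
weight-insertPeak-≥ {ω = ω} zero D _ _ = sym (+-assoc (ω true) (ω false) _)
weight-insertPeak-≥ {ω = ω} (suc m) (c ∷ D) (s≤s m≤n) (s≤s m≤t) =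
  trans (cong (ω c +_) (weight-insertPeak-≥ m D m≤n m≤t)) (swap (ω c) (ω true) (ω false) _)
  where
  swap : ∀ a x y z → a + (x + y + z) ≡ x + y + (a + z)
  swap = solve-∀

isDown : Bool → ℕ
isDown true  = 0
isDown false = 1

ups downs : Path → ℕ → ℕ
ups   = weight 𝟙
downs = weight isDown

ups+downs : ∀ D t → t ≤ length D → ups D t + downs D t ≡ t
ups+downs []      zero    _ = refl
ups+downs (c ∷ D) zero    _ = refl
ups+downs (true ∷ D)  (suc t) (s≤s t≤n) = cong suc (ups+downs D t t≤n)
ups+downs (false ∷ D) (suc t) (s≤s t≤n) = trans (+-suc _ _) (cong suc (ups+downs D t t≤n))

-- A peak adds exactly one counted step, and `weight ω D m` counted steps precede it, so the ranks
-- of the later ones move up by one. That the step `t` is itself counted matters for `t < m`: its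
-- rank is then strictly below that of the new step.
weight-punch : ∀ m D → m ≤ length D → ω true + ω false ≡ 1 → ω (step D t) ≡ 1 → t < length D →
  weight ω (insertPeak m D) (punch₂ m t) ≡ punch (weight ω D m) (weight ω D t)
weight-punch {ω} {t} m D m≤n ω≡1 ωt≡1 t<n with <-≤-connex t m
... | inj₁ t<m = begin
  weight ω (insertPeak m D) (punch₂ m t)  ≡⟨ cong (weight ω (insertPeak m D)) (punch₂-< t<m) ⟩
  weight ω (insertPeak m D) t             ≡⟨ weight-insertPeak-≤ m D m≤n (<⇒≤ t<m) ⟩
  weight ω D t                            ≡⟨ punch-< (≤-trans (≤-reflexive 1+ωt≡) (weight-mono D t<m)) ⟨
  punch (weight ω D m) (weight ω D t)     ∎
  where
  open ≡-Reasoning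
  1+ωt≡ : suc (weight ω D t) ≡ weight ω D (suc t)
  1+ωt≡ = sym (trans (weight-suc D t<n) (trans (cong (weight ω D t +_) ωt≡1) (+-comm _ 1)))
... | inj₂ m≤t = begin
  weight ω (insertPeak m D) (punch₂ m t)  ≡⟨ cong (weight ω (insertPeak m D)) (punch₂-≥ m≤t) ⟩
  weight ω (insertPeak m D) (2 + t)       ≡⟨ weight-insertPeak-≥ m D m≤n m≤t ⟩
  ω true + ω false + weight ω D t         ≡⟨ cong (_+ weight ω D t) ω≡1 ⟩
  suc (weight ω D t)                      ≡⟨ punch-≥ (weight-mono D m≤t) ⟨
  punch (weight ω D m) (weight ω D t)     ∎
  where open ≡-Reasoning

-- Heights, i.e. ups minus downs, compared with both sides moved so that no subtraction occurs.
_⊢_≈ₕ_ _⊢_<ₕ_ : Path → ℕ → ℕ → Set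
D ⊢ x ≈ₕ y = ups D x + downs D y ≡ ups D y + downs D x
D ⊢ x <ₕ y = ups D x + downs D y < ups D y + downs D x

<ₕ-≈ₕ-trans : ∀ D → D ⊢ x <ₕ y → D ⊢ y ≈ₕ t → D ⊢ x <ₕ t
<ₕ-≈ₕ-trans {x} {y} {t} D h e = +-cancelʳ-< (ups D y + downs D y) _ _ (begin-strict
  (ups D x + downs D t) + (ups D y + downs D y) ≡⟨ e₁ (ups D x) (downs D t) (ups D y) (downs D y) ⟩
  (ups D x + downs D y) + (ups D y + downs D t) <⟨ +-monoˡ-< _ h ⟩
  (ups D y + downs D x) + (ups D y + downs D t) ≡⟨ cong (ups D y + downs D x +_) e ⟩
  (ups D y + downs D x) + (ups D t + downs D y) ≡⟨ e₂ (ups D y) (downs D x) (ups D t) (downs D y) ⟩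
  (ups D t + downs D x) + (ups D y + downs D y) ∎)
  where
  open ≤-Reasoning
  e₁ : ∀ a b c d → (a + b) + (c + d) ≡ (a + d) + (c + b)
  e₁ = solve-∀
  e₂ : ∀ a b c d → (a + b) + (c + d) ≡ (c + b) + (a + d)
  e₂ = solve-∀

<ₕ-trans : ∀ D → D ⊢ x <ₕ y → D ⊢ y <ₕ t → D ⊢ x <ₕ t
<ₕ-trans {x} {y} {t} D h e = +-cancelʳ-< (ups D y + downs D y) _ _ (begin-strict
  (ups D x + downs D t) + (ups D y + downs D y) ≡⟨ e₁ (ups D x) (downs D t) (ups D y) (downs D y) ⟩
  (ups D x + downs D y) + (ups D y + downs D t) <⟨ +-mono-< h e ⟩
  (ups D y + downs D x) + (ups D t + downs D y) ≡⟨ e₂ (ups D y) (downs D x) (ups D t) (downs D y) ⟩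
  (ups D t + downs D x) + (ups D y + downs D y) ∎)
  where
  open ≤-Reasoning
  e₁ : ∀ a b c d → (a + b) + (c + d) ≡ (a + d) + (c + b)
  e₁ = solve-∀
  e₂ : ∀ a b c d → (a + b) + (c + d) ≡ (c + b) + (a + d)
  e₂ = solve-∀

-- Step `t` leads from point `t` to point `suc t`. Thus `level` speaks of the point where the step
-- `q` ends, and `above` of all points between the start of `p` and that one, which makes `q` the
-- first step to return to the starting height.
record Matched (D : Path) (p q : ℕ) : Set where
  field
    p<q    : p < q
    q<n    : q < length D
    up     : step D p ≡ true
    down   : step D q ≡ false
    level  : D ⊢ p ≈ₕ suc q
    above  : ∀ t → p < t → t ≤ q → D ⊢ p <ₕ t

-- The point m of a path becomes two points of insertPeak m D, one on either side of the peak.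
data Boundary (m : ℕ) : ℕ → ℕ → Set where
  left  : t ≤ m → Boundary m t t
  right : m ≤ t → Boundary m t (2 + t)

module _ {m : ℕ} {D : Path} (m≤n : m ≤ length D) where

  private
    D′ = insertPeak m D

  ups-boundary : Boundary m t x → ∃ λ r → ups D′ x ≡ r + ups D t × downs D′ x ≡ r + downs D t
  ups-boundary (left h)  = 0 , weight-insertPeak-≤ m D m≤n h , weight-insertPeak-≤ m D m≤n h
  ups-boundary (right h) = 1 , weight-insertPeak-≥ m D m≤n h , weight-insertPeak-≥ m D m≤n h

  private
    regroup : ∀ a b r s → (r + a) + (s + b) ≡ (a + b) + (r + s)
    regroup = solve-∀

  ≈ₕ-boundary : Boundary m t x → Boundary m k y → D ⊢ t ≈ₕ k → D′ ⊢ x ≈ₕ y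
  ≈ₕ-boundary {t} {k = k} α β e with ups-boundary α | ups-boundary β
  ... | r , u , d | s , u′ , d′ rewrite u | d | u′ | d′ =
    trans (regroup (ups D t) (downs D k) r s)
      (trans (cong₂ _+_ e (+-comm r s)) (sym (regroup (ups D k) (downs D t) s r)))

  <ₕ-boundary : Boundary m t x → Boundary m k y → D ⊢ t <ₕ k → D′ ⊢ x <ₕ y
  <ₕ-boundary {t} {k = k} α β e with ups-boundary α | ups-boundary β
  ... | r , u , d | s , u′ , d′ rewrite u | d | u′ | d′ =
    subst₂ _<_ (sym (regroup (ups D t) (downs D k) r s))
      (trans (cong (ups D k + downs D t +_) (+-comm r s)) (sym (regroup (ups D k) (downs D t) s r)))
      (+-monoˡ-< (r + s) e)

  <ₕ-summit : D′ ⊢ m <ₕ suc m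
  <ₕ-summit rewrite weight-insertPeak-mid {𝟙} m D m≤n | weight-insertPeak-mid {isDown} m D m≤n
     | weight-insertPeak-≤ {m} {𝟙} m D m≤n ≤-refl | weight-insertPeak-≤ {m} {isDown} m D m≤n ≤-refl = ≤-refl

  private
    -- Steps from position `m` on are moved behind the peak, so a tunnel starting at the point `m`
    -- takes its right copy. Dually, a tunnel ending at the point `m` keeps the left copy.
    boundary-start : ∀ p → Boundary m p (punch₂ m p)
    boundary-start p with <-≤-connex p m
    ... | inj₁ p<m rewrite punch₂-< p<m = left (<⇒≤ p<m)
    ... | inj₂ m≤p rewrite punch₂-≥ m≤p = right m≤p

    boundary-end : ∀ q → Boundary m (suc q) (suc (punch₂ m q))
    boundary-end q with <-≤-connex q m
    ... | inj₁ q<m rewrite punch₂-< q<m = left q<m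
    ... | inj₂ m≤q rewrite punch₂-≥ m≤q = right (m≤n⇒m≤1+n m≤q)

    punch₂-bound : ∀ t → t < length D → punch₂ m t < length D′
    punch₂-bound t t<n rewrite length-insertPeak m D with <-≤-connex t m
    ... | inj₁ t<m rewrite punch₂-< t<m = m<n⇒m<1+n (m<n⇒m<1+n t<n)
    ... | inj₂ m≤t rewrite punch₂-≥ m≤t = s≤s (s≤s t<n)

  Matched-peak : Matched D′ m (suc m)
  Matched-peak = record
    { p<q   = ≤-refl
    ; q<n   = subst (suc m <_) (sym (length-insertPeak m D)) (s≤s (s≤s m≤n))
    ; up    = step-peak-up m D m≤n
    ; down  = step-peak-down m D m≤n
    ; level = ≈ₕ-boundary (left {t = m} ≤-refl) (right ≤-refl) refl
    ; above = λ t m<t t≤1+m → subst (D′ ⊢ m <ₕ_) (≤-antisym m<t t≤1+m) <ₕ-summit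
    }

  Matched-insertPeak : Matched D p q → Matched D′ (punch₂ m p) (punch₂ m q)
  Matched-insertPeak {p} {q} M = record
    { p<q   = punch-mono-< m (punch-mono-< m p<q)
    ; q<n   = punch₂-bound q q<n
    ; up    = trans (step-insertPeak m D p m≤n) up
    ; down  = trans (step-insertPeak m D q m≤n) down
    ; level = ≈ₕ-boundary (boundary-start p) (boundary-end q) level
    ; above = above′
    }
    where
    open Matched M
    above′ : ∀ t → punch₂ m p < t → t ≤ punch₂ m q → D′ ⊢ punch₂ m p <ₕ t
    -- The points of the new path are the old ones up to `m`, the summit `suc m`, and the old ones
    -- from `m` on moved by two.
    above′ t p<t t≤q with <-cmp t (suc m)
    ... | tri< (s≤s t≤m) _ _ = <ₕ-boundary (boundary-start p) (left t≤m) (above t p<t′ t≤q′)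
      where
      p<t′ : p < t
      p<t′ with <-≤-connex p m
      ... | inj₁ p<m = subst (_< t) (punch₂-< p<m) p<t
      ... | inj₂ m≤p = ⊥-elim (<⇒≱ (<-≤-trans (subst (_< t) (punch₂-≥ m≤p) p<t) t≤m) (m≤n⇒m≤1+n (m≤n⇒m≤1+n m≤p)))
      t≤q′ : t ≤ q
      t≤q′ with <-≤-connex q m
      ... | inj₁ q<m = subst (t ≤_) (punch₂-< q<m) t≤q
      ... | inj₂ m≤q = ≤-trans t≤m m≤q
    -- The summit is above the left copy of `m`, and `m` is a point inside the old tunnel: the
    -- displaced endpoints can enclose the summit only if `p < m` and `m ≤ q`.
    ... | tri≈ _ refl _ = <ₕ-trans D′ (<ₕ-boundary (boundary-start p) (left ≤-refl) (above m p<m m≤q)) <ₕ-summit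
      where
      p<m : p < m
      p<m with <-≤-connex p m
      ... | inj₁ p<m = p<m
      ... | inj₂ m≤p = ⊥-elim (<⇒≱ (subst (_< suc m) (punch₂-≥ m≤p) p<t) (m≤n⇒m≤1+n (s≤s m≤p)))
      m≤q : m ≤ q
      m≤q with <-≤-connex q m
      ... | inj₁ q<m = ⊥-elim (<⇒≱ (subst (suc m ≤_) (punch₂-< q<m) t≤q) (<⇒≤ q<m))
      ... | inj₂ m≤q = m≤q
    above′ (suc (suc t)) p<t t≤q | tri> _ _ (s≤s (s≤s m≤t)) =
      <ₕ-boundary (boundary-start p) (right m≤t) (above t p<t′ t≤q′)
      where
      p<t′ : p < t
      p<t′ with <-≤-connex p m
      ... | inj₁ p<m = <-≤-trans p<m m≤t
      ... | inj₂ m≤p = s≤s⁻¹ (s≤s⁻¹ (subst (_< 2 + t) (punch₂-≥ m≤p) p<t))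
      t≤q′ : t ≤ q
      t≤q′ with <-≤-connex q m
      ... | inj₁ q<m = ⊥-elim (<⇒≱ (<-trans q<m (s≤s m≤t)) (≤-trans (n≤1+n (suc t)) (subst (2 + t ≤_) (punch₂-< q<m) t≤q)))
      ... | inj₂ m≤q = s≤s⁻¹ (s≤s⁻¹ (subst (2 + t ≤_) (punch₂-≥ m≤q) t≤q))

-- If `q < q′`, the point `suc q` would lie above `p′` and hence above `p`, with which it is level.
-- If `q′ = q`, both starting points would be level with `suc q`, although `p′` is above `p`.
Matched-nested : ∀ {D p q p′ q′} → Matched D p q → Matched D p′ q′ → p < p′ → p′ < q → q′ < q
Matched-nested {D} {p} {q} {p′} {q′} M M′ p<p′ p′<q with <-≤-connex q′ q
... | inj₁ q′<q = q′<q
... | inj₂ q≤q′ with m≤n⇒m<n∨m≡n q≤q′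
...   | inj₁ q<q′ = ⊥-elim (<-irrefl (Matched.level M)
  (<ₕ-trans D (Matched.above M p′ p<p′ (<⇒≤ p′<q)) (Matched.above M′ (suc q) (m<n⇒m<1+n p′<q) q<q′)))
...   | inj₂ refl = ⊥-elim (<-irrefl (Matched.level M)
  (<ₕ-≈ₕ-trans D (Matched.above M p′ p<p′ (<⇒≤ p′<q)) (Matched.level M′)))

Matched-nested⁻¹ : ∀ {D p q p′ q′} → Matched D p q → Matched D p′ q′ → p < q′ → q′ < q → p < p′
Matched-nested⁻¹ {D} {p} {q} {p′} {q′} M M′ p<q′ q′<q with <-cmp p p′
... | tri< p<p′ _ _ = p<p′
... | tri≈ _ refl _ = ⊥-elim (<-irrefl (Matched.level M′) (Matched.above M (suc q′) (m<n⇒m<1+n p<q′) q′<q))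
... | tri> _ _ p′<p = ⊥-elim (<-asym q′<q (Matched-nested M′ M p′<p p<q′))

-- Building a permutation, its path and its tunnels together

start mid end : Tunnel → ℕ
start (p , ℓ) = p
mid   (p , ℓ) = p + ℓ
end   (p , ℓ) = suc (p + ℓ + ℓ)

start≤mid : ∀ O → start O ≤ mid O
start≤mid (p , ℓ) = m≤m+n p ℓ

mid<end : ∀ O → mid O < end O
mid<end (p , ℓ) = s≤s (m≤m+n (p + ℓ) ℓ)

end∸mid : ∀ O → end O ∸ suc (mid O) ≡ proj₂ O
end∸mid (p , ℓ) = m+n∸m≡n (p + ℓ) ℓ

end-suc : ∀ p ℓ → end (p , suc ℓ) ≡ 2 + end (p , ℓ)
end-suc = rearranged
  where
  rearranged : ∀ p ℓ → suc (p + suc ℓ + suc ℓ) ≡ 2 + suc (p + ℓ + ℓ)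
  rearranged = solve-∀

-- In the three cases the centre of the tunnel advances by 0, 1 or 2, whereas the middle of the path
-- advances by 1. This comparison decides what happens to crossing counts and to centred tunnels.
data GrowView (m : ℕ) : Tunnel → Tunnel → Set where
  before    : ∀ {O} → end O < m → GrowView m O O
  around    : ∀ {p ℓ} → p < m → m ≤ end (p , ℓ) → GrowView m (p , ℓ) (p , suc ℓ)
  after     : ∀ {p ℓ} → m ≤ p → GrowView m (p , ℓ) (2 + p , ℓ)

grow : ℕ → Tunnel → Tunnel
grow m (p , ℓ) with <-≤-connex p m | <-≤-connex (end (p , ℓ)) m
... | inj₁ _ | inj₁ _ = p , ℓ
... | inj₁ _ | inj₂ _ = p , suc ℓ
... | inj₂ _ | _      = 2 + p , ℓ

growView : ∀ m O → GrowView m O (grow m O)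
growView m (p , ℓ) with <-≤-connex p m | <-≤-connex (end (p , ℓ)) m
... | inj₁ p<m | inj₁ q<m = before q<m
... | inj₁ p<m | inj₂ m≤q = around p<m m≤q
... | inj₂ m≤p | _        = after m≤p

start-grow : ∀ m O → start (grow m O) ≡ punch₂ m (start O)
start-grow m O with grow m O | growView m O
... | _ | before q<m   = sym (punch₂-< (≤-<-trans (start≤mid O) (<-trans (mid<end O) q<m)))
... | _ | around p<m _ = sym (punch₂-< p<m)
... | _ | after m≤p    = sym (punch₂-≥ m≤p)

end-grow : ∀ m O → end (grow m O) ≡ punch₂ m (end O)
end-grow m O with grow m O | growView m O
... | _ | before q<m              = sym (punch₂-< q<m)
... | _ | around {p} {ℓ} _ m≤q    = trans (end-suc p ℓ) (sym (punch₂-≥ m≤q))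
... | _ | after m≤p               = sym (punch₂-≥ (≤-trans m≤p (≤-trans (start≤mid O) (<⇒≤ (mid<end O)))))

extend : ℕ → List ℕ → List ℕ
extend m τ = map (punch (suc m)) τ ++ suc m ∷ []

-- B bounds the values τ(i) < i, which increase with i in a 321-avoiding permutation;
-- the next value is either the new maximum or such a value, hence larger than B.
data Next : ℕ → ℕ → ℕ → ℕ → Set where
  top : Next n B n B
  low : B ≤ m → m < n → Next n B m (suc m)

data Build : ℕ → ℕ → List ℕ → Path → List Tunnel → Set where
  nil : Build 0 0 [] [] []
  add : ∀ {Ts} → Build n B τ D Ts → Next n B m B′ →
         Build (suc n) B′ (extend m τ) (insertPeak m D) ((m , 0) ∷ map (grow m) Ts)

Next-≤ : Next n B m B′ → m ≤ n
Next-≤ top         = ≤-refl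
Next-≤ (low _ m<n) = <⇒≤ m<n

Build-bound : Build n B τ D Ts → B ≤ n
Build-bound nil                   = z≤n
Build-bound (add bu top)          = m≤n⇒m≤1+n (Build-bound bu)
Build-bound (add bu (low _ m<n))  = m≤n⇒m≤1+n m<n

Next-≥ : ∀ {Ts} → Build n B τ D Ts → Next n B m B′ → B ≤ m
Next-≥ bu top         = Build-bound bu
Next-≥ bu (low B≤m _) = B≤m

length-path : Build n B τ D Ts → length D ≡ n + n
length-path nil = refl
length-path (add {n = n} {m = m} bu _) =
  trans (length-insertPeak m _) (cong suc (trans (cong suc (length-path bu)) (sym (+-suc n n))))

length-perm : Build n B τ D Ts → length τ ≡ n
length-perm nil = refl
length-perm {τ = τ} (add {n = n} {τ = τ₀} {m = m} bu _) =
  trans (length-++ (map (punch (suc m)) τ₀)) (trans (cong (_+ 1) (trans (length-map (punch (suc m)) τ₀) (length-perm bu))) (+-comm n 1))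

≤-length-path : Build n B τ D Ts → m ≤ n → m ≤ length D
≤-length-path {n = n} bu m≤n = subst (_ ≤_) (sym (length-path bu)) (≤-trans m≤n (m≤m+n n n))

tunnels-matched : Build n B τ D Ts → All (λ O → Matched D (start O) (end O)) Ts
tunnels-matched nil = []
tunnels-matched (add {n = n} {D = D} {m = m} {Ts = Ts} bu nx) =
  subst (Matched (insertPeak m D) m) (cong suc (sym (trans (+-identityʳ (m + 0)) (+-identityʳ m)))) (Matched-peak m≤D)
  ∷ All.map⁺ (All-map (λ {O} M → subst₂ (Matched (insertPeak m D)) (sym (start-grow m O)) (sym (end-grow m O)) (Matched-insertPeak m≤D M)) (tunnels-matched bu))
  where
  m≤D : m ≤ length D
  m≤D = ≤-length-path bu (Next-≤ nx)

-- With `g` arbitrary this says that the ranks of the up steps of the tunnels are all numbers below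
-- `n`, each once. The new peak takes rank `ups D m` and the older ranks skip it, so the induction
-- hypothesis is used for `g ∘ punch (ups D m)`.
∑-starts : Build n B τ D Ts → (g : ℕ → ℕ) → ∑∈ Ts (g ∘ ups D ∘ start) ≡ ∑< n g
∑-starts nil g = refl
∑-starts (add {n = n} {D = D} {m = m} {Ts = Ts} bu nx) g = begin
  g (ups D′ m) + ∑∈ (map (grow m) Ts) (g ∘ ups D′ ∘ start)
    ≡⟨ cong₂ _+_ (cong g (weight-insertPeak-≤ m D m≤D ≤-refl)) (∑∈-map Ts) ⟩
  g (ups D m) + ∑∈ Ts (g ∘ ups D′ ∘ start ∘ grow m)
    ≡⟨ cong (g (ups D m) +_) (∑∈-cong (All-map (λ {O} M → cong g (trans (cong (ups D′) (start-grow m O))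
         (weight-punch m D m≤D refl (cong 𝟙 (Matched.up M)) (<-trans (Matched.p<q M) (Matched.q<n M))))) (tunnels-matched bu))) ⟩
  g (ups D m) + ∑∈ Ts (g ∘ punch (ups D m) ∘ ups D ∘ start)
    ≡⟨ cong (g (ups D m) +_) (∑-starts bu (g ∘ punch (ups D m))) ⟩
  g (ups D m) + ∑< n (g ∘ punch (ups D m))
    ≡⟨ ∑<-punch n g (≤-trans (≤-trans (m≤m+n _ _) (≤-reflexive (ups+downs D m m≤D))) (Next-≤ nx)) ⟨
  ∑< (suc n) g ∎
  where
  open ≡-Reasoning
  D′ = insertPeak m D
  m≤D : m ≤ length D
  m≤D = ≤-length-path bu (Next-≤ nx)

∑-ends : Build n B τ D Ts → (g : ℕ → ℕ) → ∑∈ Ts (g ∘ downs D ∘ end) ≡ ∑< n g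
∑-ends nil g = refl
∑-ends (add {n = n} {D = D} {m = m} {Ts = Ts} bu nx) g = begin
  g (downs D′ (suc (m + 0 + 0))) + ∑∈ (map (grow m) Ts) (g ∘ downs D′ ∘ end)
    ≡⟨ cong₂ _+_ (cong g (trans (cong (downs D′ ∘ suc) (trans (+-identityʳ (m + 0)) (+-identityʳ m))) (weight-insertPeak-mid m D m≤D))) (∑∈-map Ts) ⟩
  g (downs D m) + ∑∈ Ts (g ∘ downs D′ ∘ end ∘ grow m)
    ≡⟨ cong (g (downs D m) +_) (∑∈-cong (All-map (λ {O} M → cong g (trans (cong (downs D′) (end-grow m O))
         (weight-punch m D m≤D refl (cong isDown (Matched.down M)) (Matched.q<n M)))) (tunnels-matched bu))) ⟩
  g (downs D m) + ∑∈ Ts (g ∘ punch (downs D m) ∘ downs D ∘ end)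
    ≡⟨ cong (g (downs D m) +_) (∑-ends bu (g ∘ punch (downs D m))) ⟩
  g (downs D m) + ∑< n (g ∘ punch (downs D m))
    ≡⟨ ∑<-punch n g (≤-trans (≤-trans (m≤n+m _ _) (≤-reflexive (ups+downs D m m≤D))) (Next-≤ nx)) ⟨
  ∑< (suc n) g ∎
  where
  open ≡-Reasoning
  D′ = insertPeak m D
  m≤D : m ≤ length D
  m≤D = ≤-length-path bu (Next-≤ nx)

-- With the indicator of an interval for `g`, this turns the endpoint counts of all tunnels into the
-- length of the interval.
∑-positions : Build n B τ D Ts → (g : ℕ → ℕ) → ∑∈ Ts (λ O → g (start O) + g (end O)) ≡ ∑< (n + n) g
∑-positions nil g = refl
∑-positions (add {n = n} {m = m} {Ts = Ts} bu nx) g = begin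
  g m + g (suc (m + 0 + 0)) + ∑∈ (map (grow m) Ts) (λ O → g (start O) + g (end O))
    ≡⟨ cong₂ _+_ (cong (λ z → g m + g (suc z)) (trans (+-identityʳ (m + 0)) (+-identityʳ m))) (∑∈-map Ts) ⟩
  g m + g (suc m) + ∑∈ Ts (λ O → g (start (grow m O)) + g (end (grow m O)))
    ≡⟨ cong (g m + g (suc m) +_) (∑∈-cong (All-map (λ {O} _ → cong₂ (λ x y → g x + g y) (start-grow m O) (end-grow m O)) (tunnels-matched bu))) ⟩
  g m + g (suc m) + ∑∈ Ts (λ O → g (punch₂ m (start O)) + g (punch₂ m (end O)))
    ≡⟨ cong (g m + g (suc m) +_) (∑-positions bu (g ∘ punch₂ m)) ⟩
  g m + g (suc m) + ∑< (n + n) (g ∘ punch₂ m)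
    ≡⟨ ∑<-punch₂ (n + n) g (≤-trans (Next-≤ nx) (m≤m+n n n)) ⟨
  ∑< (2 + (n + n)) g
    ≡⟨ cong (λ z → ∑< z g) (cong suc (+-suc n n)) ⟨
  ∑< (suc n + suc n) g ∎
  where open ≡-Reasoning

-- The centre of the tunnel is above the point `suc (mid O)`, and `n` is the middle of the path.
-- Between the points `B` and `n` there are only down steps followed by up steps, so a tunnel whose
-- up step lies there has its centre at the middle or beyond. The induction obtains this from the
-- growth steps directly.
left-bounded : Build n B τ D Ts → All (λ O → suc (mid O) < n → start O < B) Ts
left-bounded nil = []
left-bounded (add {n = n} {m = m} bu nx) =
  new nx ∷ All.map⁺ (All-map (λ {O} → old nx O) (left-bounded bu))
  where
  new : ∀ {B B′ m} → Next n B m B′ → suc (m + 0) < suc n → m < B′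
  new {m = m} top       h = ⊥-elim (<-irrefl (+-identityʳ m) (s≤s⁻¹ h))
  new (low _ _) _ = ≤-refl
  old : ∀ {B B′ m} → Next n B m B′ → ∀ O → (suc (mid O) < n → start O < B) →
        suc (mid (grow m O)) < suc n → start (grow m O) < B′
  old {m = m} nx O ih h with grow m O | growView m O
  old top O ih h         | _ | before q<m = ih (≤-<-trans (mid<end O) q<m)
  old (low _ _) O ih h   | _ | before q<m = m<n⇒m<1+n (≤-<-trans (start≤mid O) (<-trans (mid<end O) q<m))
  old top _ ih h         | _ | around {p} {ℓ} p<m _ = ih (subst (_< n) (+-suc p ℓ) (s≤s⁻¹ h))
  old (low _ _) _ ih h   | _ | around p<m _ = m<n⇒m<1+n p<m
  old top _ ih h         | _ | after {p} {ℓ} m≤p =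
    ⊥-elim (<⇒≱ (s≤s⁻¹ h) (≤-trans m≤p (≤-trans (m≤m+n p ℓ) (≤-trans (n≤1+n _) (n≤1+n _)))))
  old (low B≤m _) _ ih h | _ | after {p} {ℓ} m≤p =
    ⊥-elim (<⇒≱ (ih (≤-trans (n≤1+n _) (s≤s⁻¹ h))) (≤-trans B≤m m≤p))

-- The first term will count lower crossings, the second one upper crossings.
crossingsInside : ℕ → Tunnel → ℕ
crossingsInside n O = ((end O ⊓ n) ∸ suc (mid O)) + (mid O ∸ (start O ⊔ n))

-- Change of the crossings inside a tunnel under growth

crossingsInside-left : ∀ O → end O ≤ n → crossingsInside n O ≡ proj₂ O
crossingsInside-left {n} O q≤n = trans
  (cong₂ _+_ (trans (cong (_∸ suc (mid O)) (m≤n⇒m⊓n≡m q≤n)) (end∸mid O))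
             (m≤n⇒m∸n≡0 (≤-trans (≤-trans (<⇒≤ (mid<end O)) q≤n) (m≤n⊔m (start O) n))))
  (+-identityʳ (proj₂ O))

crossingsInside-right : ∀ O → n ≤ start O → crossingsInside n O ≡ proj₂ O
crossingsInside-right {n} O@(p , ℓ) n≤p = cong₂ _+_
  (m≤n⇒m∸n≡0 (≤-trans (m⊓n≤n (end O) n) (≤-trans n≤p (≤-trans (start≤mid O) (n≤1+n (mid O))))))
  (trans (cong (mid O ∸_) (m≥n⇒m⊔n≡m n≤p)) (m+n∸m≡n p ℓ))

crossingsInside-centre : ∀ O → start O ≤ n → n ≤ end O →
  crossingsInside n O ≡ (n ∸ suc (mid O)) + (mid O ∸ n)
crossingsInside-centre O p≤n n≤q =
  cong₂ _+_ (cong (_∸ suc (mid O)) (m≥n⇒m⊓n≡n n≤q)) (cong (mid O ∸_) (m≤n⇒m⊔n≡n p≤n))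

centred : ℕ → Tunnel → ℕ
centred n O = [ suc (mid O) ≟ n ]

within : ℕ → ℕ → ℕ → ℕ
within a b t = [ (a ≤? t) ×-dec (t <? b) ]

within-1 : a ≤ t → t < b → within a b t ≡ 1
within-1 {a} {t} {b} h k = χ-yes ((a ≤? t) ×-dec (t <? b)) (h , k)

within-0ˡ : t < a → within a b t ≡ 0
within-0ˡ {t} {a} {b} h = χ-no ((a ≤? t) ×-dec (t <? b)) (λ (k , _) → <⇒≱ h k)

within-0ʳ : b ≤ t → within a b t ≡ 0
within-0ʳ {b} {t} {a} h = χ-no ((a ≤? t) ×-dec (t <? b)) (λ (_ , k) → <⇒≱ k h)

-- The truncated difference fails to grow exactly when `suc s = n`, where it is 0 before and after;
-- the indicator makes up for it. This is where centred tunnels enter the increment.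
∸-step : ∀ {s} → n ≤ suc s → (suc s ∸ n) + [ suc s ≟ n ] * 1 ≡ (s ∸ n) + 1
∸-step {n} {s} n≤1+s with m≤n⇒m<n∨m≡n n≤1+s
... | inj₁ (s≤s n≤s) rewrite χ-no (suc s ≟ n) (λ e → <⇒≱ (≤-reflexive e) n≤s) =
  trans (+-identityʳ _) (trans (+-∸-assoc 1 n≤s) (+-comm 1 _))
... | inj₂ refl rewrite χ-yes (suc s ≟ n) refl | n∸n≡0 s | m≤n⇒m∸n≡0 (n≤1+n s) = refl

-- A tunnel around the peak becomes longer by two, which matters only if it ends before the middle;
-- otherwise its centre and the middle advance together. A tunnel behind the peak advances by two
-- against one for the middle, which matters only if it starts before the middle. The last
-- hypothesis keeps such a tunnel from having its centre left of the middle, where its count would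
-- not grow.
crossingsInside-grow : ∀ O → m ≤ n → (suc (mid O) < n → start O < m) →
  crossingsInside (suc n) (grow m O) + centred n O * [ m ≤? start O ] ≡
  crossingsInside n O + (within m n (start O) + within m n (end O))
crossingsInside-grow {m} {n} O m≤n lb with grow m O | growView m O
... | _ | before q<m
  rewrite crossingsInside-left {n} O (≤-trans (<⇒≤ q<m) m≤n)
        | crossingsInside-left {suc n} O (m≤n⇒m≤1+n (≤-trans (<⇒≤ q<m) m≤n))
        | χ-no (m ≤? start O) (<⇒≱ (≤-<-trans (start≤mid O) (<-trans (mid<end O) q<m)))
        | within-0ˡ {b = n} (≤-<-trans (start≤mid O) (<-trans (mid<end O) q<m))
        | within-0ˡ {b = n} q<m
        | *-zeroʳ (centred n O) = refl
... | _ | around {p} {ℓ} p<m m≤q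
  rewrite χ-no (m ≤? p) (<⇒≱ p<m)
        | within-0ˡ {b = n} p<m
        | *-zeroʳ (centred n O)
  with <-≤-connex (end O) n
...   | inj₁ q<n
  rewrite crossingsInside-left {n} O (<⇒≤ q<n)
        | crossingsInside-left {suc n} (p , suc ℓ) (subst (_≤ suc n) (sym (end-suc p ℓ)) (s≤s q<n))
        | within-1 m≤q q<n = trans (+-identityʳ _) (+-comm 1 ℓ)
...   | inj₂ n≤q
  rewrite crossingsInside-centre {n} O (≤-trans (<⇒≤ p<m) m≤n) n≤q
        | crossingsInside-centre {suc n} (p , suc ℓ) (m≤n⇒m≤1+n (≤-trans (<⇒≤ p<m) m≤n)) (≤-trans (s≤s n≤q) (≤-trans (n≤1+n _) (≤-reflexive (sym (end-suc p ℓ)))))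
        | within-0ʳ {a = m} n≤q
        | +-suc p ℓ = refl
crossingsInside-grow {m} {n} O m≤n lb | _ | after {p} {ℓ} m≤p with <-≤-connex p n
... | inj₂ n≤p
  rewrite crossingsInside-right {n} O n≤p
        | crossingsInside-right {suc n} (2 + p , ℓ) (s≤s (m≤n⇒m≤1+n n≤p))
        | within-0ʳ {a = m} n≤p
        | within-0ʳ {a = m} (≤-trans n≤p (≤-trans (start≤mid O) (<⇒≤ (mid<end O))))
        | χ-no (suc (mid O) ≟ n) (λ e → <⇒≱ (≤-reflexive e) (≤-trans n≤p (start≤mid O))) = refl
... | inj₁ p<n with ≮⇒≥ {suc (p + ℓ)} {n} (λ h → <⇒≱ (lb h) m≤p)
...   | n≤1+s
  rewrite crossingsInside-centre {n} O (<⇒≤ p<n) (≤-trans n≤1+s (mid<end O))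
        | crossingsInside-centre {suc n} (2 + p , ℓ) (s≤s p<n) (s≤s (≤-trans n≤1+s (≤-trans (n≤1+n _) (s≤s (mid<end O)))))
        | within-1 m≤p p<n
        | within-0ʳ {a = m} (≤-trans n≤1+s (mid<end O))
        | χ-yes (m ≤? p) m≤p
        | m≤n⇒m∸n≡0 n≤1+s
        | m≤n⇒m∸n≡0 (≤-trans n≤1+s (n≤1+n (suc (p + ℓ)))) = ∸-step n≤1+s

∑-crossingsInside-grow : ∀ {Ts} → Build n B τ D Ts → Next n B m B′ →
  ∑∈ ((m , 0) ∷ map (grow m) Ts) (crossingsInside (suc n)) + ∑∈ Ts (λ O → centred n O * [ m ≤? start O ])
  ≡ ∑∈ Ts (crossingsInside n) + (n ∸ m)
∑-crossingsInside-grow {n} {B} {m = m} {Ts = Ts} bu nx = begin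
  crossingsInside (suc n) (m , 0) + ∑∈ (map (grow m) Ts) (crossingsInside (suc n)) + C
    ≡⟨ cong (_+ C) (cong₂ _+_ new (∑∈-map Ts)) ⟩
  ∑∈ Ts (crossingsInside (suc n) ∘ grow m) + C
    ≡⟨ ∑∈-+ Ts ⟨
  ∑∈ Ts (λ O → crossingsInside (suc n) (grow m O) + centred n O * [ m ≤? start O ])
    ≡⟨ ∑∈-cong (All-map (λ {O} lb → crossingsInside-grow O (Next-≤ nx) λ h → <-≤-trans (lb h) (Next-≥ bu nx)) (left-bounded bu)) ⟩
  ∑∈ Ts (λ O → crossingsInside n O + (within m n (start O) + within m n (end O)))
    ≡⟨ ∑∈-+ Ts ⟩
  ∑∈ Ts (crossingsInside n) + ∑∈ Ts (λ O → within m n (start O) + within m n (end O))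
    ≡⟨ cong (∑∈ Ts (crossingsInside n) +_) (trans (∑-positions bu (within m n)) (∑<-interval {n} {m} (n + n) (m≤m+n n n))) ⟩
  ∑∈ Ts (crossingsInside n) + (n ∸ m) ∎
  where
  open ≡-Reasoning
  C = ∑∈ Ts (λ O → centred n O * [ m ≤? start O ])
  new : crossingsInside (suc n) (m , 0) ≡ 0
  new = crossingsInside-left (m , 0)
    (s≤s (subst (_≤ n) (sym (trans (+-identityʳ (m + 0)) (+-identityʳ m))) (Next-≤ nx)))

-- Crossings of a 321-avoiding permutation

nth-++ˡ : ∀ {A : Set} {d : A} xs {ys} → i < length xs → nth d (xs ++ ys) i ≡ nth d xs i
nth-++ˡ {zero}  (x ∷ xs) _         = refl
nth-++ˡ {suc i} (x ∷ xs) (s≤s i<n) = nth-++ˡ xs i<n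

nth-++-length : ∀ {A : Set} {d : A} xs {y ys} → nth d (xs ++ y ∷ ys) (length xs) ≡ y
nth-++-length []       = refl
nth-++-length (x ∷ xs) = nth-++-length xs

nth-map : ∀ {A B : Set} {d : A} {d′ : B} (f : A → B) xs → i < length xs → nth d′ (map f xs) i ≡ f (nth d xs i)
nth-map {zero}  f (x ∷ xs) _         = refl
nth-map {suc i} f (x ∷ xs) (s≤s i<n) = nth-map f xs i<n

nth-extend-< : ∀ τ → i < length τ → nth 0 (extend m τ) i ≡ punch (suc m) (nth 0 τ i)
nth-extend-< {i} {m} τ i<n = trans
  (nth-++ˡ (map (punch (suc m)) τ) (subst (i <_) (sym (length-map (punch (suc m)) τ)) i<n))
  (nth-map (punch (suc m)) τ i<n)

nth-extend-last : ∀ τ → nth 0 (extend m τ) (length τ) ≡ suc m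
nth-extend-last {m} τ = trans
  (cong (nth 0 (extend m τ)) (sym (length-map (punch (suc m)) τ)))
  (nth-++-length (map (punch (suc m)) τ))

≤-punch : ∀ a t → t ≤ punch a t
≤-punch zero    t       = n≤1+n t
≤-punch (suc a) zero    = z≤n
≤-punch (suc a) (suc t) = s≤s (≤-punch a t)

punch-≤-suc : ∀ a t → punch a t ≤ suc t
punch-≤-suc zero    t       = ≤-refl
punch-≤-suc (suc a) zero    = z≤n
punch-≤-suc (suc a) (suc t) = s≤s (punch-≤-suc a t)

nth-extend-<′ : Build n B τ D Ts → i < n → nth 0 (extend m τ) i ≡ punch (suc m) (nth 0 τ i)
nth-extend-<′ {τ = τ} {i = i} bu i<n = nth-extend-< τ (subst (i <_) (sym (length-perm bu)) i<n)

nth-extend-last′ : Build n B τ D Ts → nth 0 (extend m τ) n ≡ suc m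
nth-extend-last′ {τ = τ} {m = m} bu =
  subst (λ k → nth 0 (extend m τ) k ≡ suc m) (length-perm bu) (nth-extend-last τ)

-- Positions count from 0 and values from 1, so `nth 0 τ i ≤ i` means that the value is smaller than
-- its position. Such values are at most `B ≤ m` and are never raised, so they can only be bounded
-- anew by the appended value.
deficient-≤ : Build n B τ D Ts → ∀ i → i < n → nth 0 τ i ≤ i → nth 0 τ i ≤ B
deficient-≤ (add {n = n} {τ = τ} {m = m} bu nx) i (s≤s i≤n) h with m≤n⇒m<n∨m≡n i≤n
... | inj₁ i<n rewrite nth-extend-<′ {m = m} bu i<n = old nx
  where
  old : ∀ {B′} → Next n _ m B′ → punch (suc m) (nth 0 τ i) ≤ B′
  ih : nth 0 τ i ≤ _
  ih = deficient-≤ bu i i<n (≤-trans (≤-punch (suc m) (nth 0 τ i)) h)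
  ih′ : nth 0 τ i ≤ m
  ih′ = ≤-trans ih (Next-≥ bu nx)
  old top       rewrite punch-< (s≤s ih′) = ih
  old (low _ _) rewrite punch-< (s≤s ih′) = m≤n⇒m≤1+n ih′
... | inj₂ refl rewrite nth-extend-last′ {m = m} bu = new nx h
  where
  new : ∀ {B B′ n m} → Next n B m B′ → suc m ≤ n → suc m ≤ B′
  new top       1+n≤n = ⊥-elim (<-irrefl refl 1+n≤n)
  new (low _ _) _     = ≤-refl

-- The permutation property of `τ`: with the indicator of a value for `g`, that value is seen to
-- occur exactly once.
∑-values : Build n B τ D Ts → (g : ℕ → ℕ) → ∑< n (g ∘ nth 0 τ) ≡ ∑< n (g ∘ suc)
∑-values nil g = refl
∑-values (add {n = n} {τ = τ} {m = m} bu nx) g = begin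
  ∑< n (g ∘ nth 0 (extend m τ)) + g (nth 0 (extend m τ) n)
    ≡⟨ cong₂ _+_ (∑<-cong n λ i i<n → cong g (nth-extend-<′ bu i<n)) (cong g (nth-extend-last′ bu)) ⟩
  ∑< n (g ∘ punch (suc m) ∘ nth 0 τ) + g (suc m)
    ≡⟨ cong (_+ g (suc m)) (∑-values bu (g ∘ punch (suc m))) ⟩
  ∑< n (g ∘ suc ∘ punch m) + g (suc m)
    ≡⟨ +-comm _ (g (suc m)) ⟩
  g (suc m) + ∑< n (g ∘ suc ∘ punch m)
    ≡⟨ ∑<-punch n (g ∘ suc) (Next-≤ nx) ⟨
  ∑< (suc n) (g ∘ suc) ∎
  where open ≡-Reasoning

-- Fixed points and centred tunnels

fixed : List ℕ → ℕ → ℕ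
fixed τ i = [ nth 0 τ i ≟ suc i ]

-- Only a tunnel around the peak can be centred afterwards, and it was centred already, since its
-- centre advances with the middle. One behind the peak would need a centre one point left of the
-- old middle, which the last hypothesis excludes.
centred-grow : ∀ (g : ℕ → ℕ) O → m ≤ n → (suc (mid O) < n → start O < m) →
  centred (suc n) (grow m O) * g (start (grow m O)) ≡ centred n O * ([ start O <? m ] * g (start O))
centred-grow {m} {n} g O m≤n lb with grow m O | growView m O
... | _ | before q<m
  rewrite χ-no (suc (mid O) ≟ suc n) (<⇒≢ (s≤s (<-trans (mid<end O) (<-≤-trans q<m m≤n))))
        | χ-no (suc (mid O) ≟ n) (<⇒≢ (≤-<-trans (mid<end O) (<-≤-trans q<m m≤n))) = refl
... | _ | around {p} {ℓ} p<m _
  rewrite χ-yes (p <? m) p<m | +-identityʳ (g p) =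
  cong (_* g p) (χ-cong (suc (p + suc ℓ) ≟ suc n) (suc (p + ℓ) ≟ n)
    (λ e → trans (sym (+-suc p ℓ)) (suc-injective e)) (λ e → cong suc (trans (+-suc p ℓ) e)))
... | _ | after {p} {ℓ} m≤p
  rewrite χ-no (p <? m) (≤⇒≯ m≤p) | *-zeroʳ [ suc (p + ℓ) ≟ n ]
        | χ-no (suc (2 + p + ℓ) ≟ suc n) (λ e → <⇒≱ (lb (≤-reflexive (suc-injective e))) m≤p) = refl

-- No old position beyond `m` is fixed any more: a value at least as large as the position is raised
-- past it, and a smaller value is at most `m`, hence stays smaller.
fixed-extend : Build n B τ D Ts → Next n B m B′ → i < n →
  fixed (extend m τ) i ≡ fixed τ i * [ i <? m ]
fixed-extend {n} {τ = τ} {m = m} {i = i} bu nx i<n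
  rewrite nth-extend-<′ {m = m} bu i<n with <-≤-connex i m
... | inj₁ i<m rewrite χ-yes (i <? m) i<m | *-identityʳ (fixed τ i) =
  χ-cong (punch (suc m) (nth 0 τ i) ≟ suc i) (nth 0 τ i ≟ suc i)
    (λ e → trans (sym (punch-< (s≤s (≤-trans (≤-punch (suc m) _) (≤-trans (≤-reflexive e) i<m))))) e)
    (λ e → trans (cong (punch (suc m)) e) (punch-< (s≤s i<m)))
... | inj₂ m≤i rewrite χ-no (i <? m) (≤⇒≯ m≤i) | *-zeroʳ (fixed τ i) =
  χ-no (punch (suc m) (nth 0 τ i) ≟ suc i) λ e → contra e (<-≤-connex (nth 0 τ i) (suc i))
  where
  contra : punch (suc m) (nth 0 τ i) ≡ suc i → nth 0 τ i < suc i ⊎ suc i ≤ nth 0 τ i → ⊥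
  contra e (inj₁ (s≤s h)) = <-irrefl (trans (sym (punch-< (s≤s (≤-trans (deficient-≤ bu i i<n h) (Next-≥ bu nx))))) e) (s≤s h)
  contra e (inj₂ h) = <-irrefl refl (≤-trans (s≤s h) (≤-reflexive (trans (sym (punch-≥ (≤-trans (s≤s m≤i) h))) e)))

-- The centred tunnel of a fixed point starts at its position, counted from 0. The weight `g` is
-- there for the induction: growth multiplies it by the indicator of `i < m`. The new peak is
-- centred and the new entry fixed in the same case `m = n`.
∑-centred : Build n B τ D Ts → (g : ℕ → ℕ) →
  ∑∈ Ts (λ O → centred n O * g (start O)) ≡ ∑< n (λ i → fixed τ i * g i)
∑-centred nil g = refl
∑-centred (add {n = n} {τ = τ} {m = m} {Ts = Ts} bu nx) g = begin
  centred (suc n) (m , 0) * g m + ∑∈ (map (grow m) Ts) (λ O → centred (suc n) O * g (start O))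
    ≡⟨ cong₂ _+_ new (∑∈-map Ts) ⟩
  fixed τ′ n * g n + ∑∈ Ts (λ O → centred (suc n) (grow m O) * g (start (grow m O)))
    ≡⟨ cong (fixed τ′ n * g n +_) (∑∈-cong (All-map (λ {O} lb →
         centred-grow g O (Next-≤ nx) λ h → <-≤-trans (lb h) (Next-≥ bu nx)) (left-bounded bu))) ⟩
  fixed τ′ n * g n + ∑∈ Ts (λ O → centred n O * ([ start O <? m ] * g (start O)))
    ≡⟨ cong (fixed τ′ n * g n +_) (∑-centred bu (λ i → [ i <? m ] * g i)) ⟩
  fixed τ′ n * g n + ∑< n (λ i → fixed τ i * ([ i <? m ] * g i))
    ≡⟨ +-comm (fixed τ′ n * g n) _ ⟩
  ∑< n (λ i → fixed τ i * ([ i <? m ] * g i)) + fixed τ′ n * g n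
    ≡⟨ cong (_+ fixed τ′ n * g n) (∑<-cong n λ i i<n →
         trans (sym (*-assoc (fixed τ i) _ _)) (cong (_* g i) (sym (fixed-extend bu nx i<n)))) ⟩
  ∑< (suc n) (λ i → fixed τ′ i * g i) ∎
  where
  open ≡-Reasoning
  τ′ = extend m τ
  new : centred (suc n) (m , 0) * g m ≡ fixed τ′ n * g n
  new rewrite nth-extend-last′ {m = m} bu | +-identityʳ m with m ≟ n
  ... | yes refl = refl
  ... | no m≢n rewrite χ-no (suc m ≟ suc n) (m≢n ∘ suc-injective) = refl

-- Crossings gained in a growth step

Crosses : ℕ → ℕ → ℕ → ℕ → Set
Crosses i a j b = (i < j × j < a × a < b) ⊎ (a < b × b ≤ i × i < j)

crosses? : ∀ i a j b → Dec (Crosses i a j b)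
crosses? i a j b =
  ((i <? j) ×-dec (j <? a) ×-dec (a <? b)) ⊎-dec ((a <? b) ×-dec (b ≤? i) ×-dec (i <? j))

∑crossings : ℕ → (ℕ → ℕ) → ℕ
∑crossings n ρ = ∑< n λ i → ∑< n λ j → [ crosses? (suc i) (ρ i) (suc j) (ρ j) ]

-- No crossing is lost: order is preserved, and in a lower crossing `b` is smaller than its
-- position, hence not raised. A new one arises only when the value `a` equals the later position
-- and is raised past it.
Crosses-punch : ∀ {a b i j m} → (b ≤ j → b ≤ m) →
  [ crosses? (suc i) (punch (suc m) a) (suc j) (punch (suc m) b) ] ≡
  [ crosses? (suc i) a (suc j) b ] + [ (i <? j) ×-dec (a ≟ suc j) ×-dec (suc j <? b) ×-dec (m ≤? j) ]
Crosses-punch {a} {b} {i} {j} {m} deficient = χ-disjoint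
  (crosses? (suc i) (punch (suc m) a) (suc j) (punch (suc m) b)) (crosses? (suc i) a (suc j) b)
  ((i <? j) ×-dec (a ≟ suc j) ×-dec (suc j <? b) ×-dec (m ≤? j))
  split old new disjoint
  where
  New : Set
  New = i < j × a ≡ suc j × suc j < b × m ≤ j

  split : Crosses (suc i) (punch (suc m) a) (suc j) (punch (suc m) b) → Crosses (suc i) a (suc j) b ⊎ New
  split (inj₂ (a<b , b≤i , i<j)) = inj₁ (inj₂ (punch-cancel-< (suc m) a<b , ≤-trans (≤-punch (suc m) b) b≤i , i<j))
  split (inj₁ (i<j , j<a , a<b)) with <-≤-connex (suc j) a | <-≤-connex a (suc m)
  ... | inj₁ j<a′ | _        = inj₁ (inj₁ (i<j , j<a′ , punch-cancel-< (suc m) a<b))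
  ... | inj₂ a≤j  | inj₁ a≤m = ⊥-elim (<⇒≱ (subst (suc j <_) (punch-< a≤m) j<a) a≤j)
  ... | inj₂ a≤j  | inj₂ m<a = inj₂ (s≤s⁻¹ i<j , a≡j , subst (_< b) a≡j (punch-cancel-< (suc m) a<b) , s≤s⁻¹ (≤-trans m<a a≤j))
    where
    a≡j : a ≡ suc j
    a≡j = ≤-antisym a≤j (s≤s⁻¹ (≤-trans j<a (punch-≤-suc (suc m) a)))

  old : Crosses (suc i) a (suc j) b → Crosses (suc i) (punch (suc m) a) (suc j) (punch (suc m) b)
  old (inj₁ (i<j , j<a , a<b)) = inj₁ (i<j , <-≤-trans j<a (≤-punch (suc m) a) , punch-mono-< (suc m) a<b)
  old (inj₂ (a<b , b≤i , i<j)) =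
    inj₂ (punch-mono-< (suc m) a<b , ≤-trans (≤-reflexive (punch-< (s≤s (deficient (≤-trans b≤i (s≤s⁻¹ i<j)))))) b≤i , i<j)

  new : New → Crosses (suc i) (punch (suc m) a) (suc j) (punch (suc m) b)
  new (i<j , refl , j<b , m≤j) =
    inj₁ (s≤s i<j , ≤-reflexive (sym (punch-≥ (s≤s m≤j))) , punch-mono-< (suc m) j<b)

  disjoint : Crosses (suc i) a (suc j) b → ¬ New
  disjoint (inj₁ (_ , j<a , _)) (_ , refl , _ , _) = <-irrefl refl j<a
  disjoint (inj₂ (_ , b≤i , i<j)) (_ , _ , j<b , _) = <-asym (≤-<-trans b≤i i<j) j<b

-- `Z` counts the new upper crossings by their right position, `L` the lower crossings with the
-- appended entry by their left position. A position from `m` on falls under exactly one of `Z`, `L`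
-- and the fixed points, because a value smaller than its position is at most `m`.
∑crossings-extend : Build n B τ D Ts → Next n B m B′ →
  ∑crossings (suc n) (nth 0 (extend m τ)) + ∑< n (λ i → fixed τ i * [ m ≤? i ]) ≡ ∑crossings n (nth 0 τ) + (n ∸ m)
∑crossings-extend {n} {B} {τ} {m = m} bu nx = begin
  ∑< n (λ i → ∑< n (X′ i) + X′ i n) + (∑< n (X′ n) + X′ n n) + F
    ≡⟨ cong (λ z → ∑< n (λ i → ∑< n (X′ i) + X′ i n) + z + F) (∑<-zero (suc n) λ j j≤n → last-first j j≤n) ⟩
  ∑< n (λ i → ∑< n (X′ i) + X′ i n) + 0 + F
    ≡⟨ cong (_+ F) (+-identityʳ _) ⟩
  ∑< n (λ i → ∑< n (X′ i) + X′ i n) + F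
    ≡⟨ cong (_+ F) (∑<-cong n λ i i<n → cong₂ _+_ (trans (∑<-cong n λ j j<n → both-old i j i<n j<n) (∑<-+ n)) (last-second i i<n)) ⟩
  ∑< n (λ i → ∑< n (X i) + ∑< n (Y i) + L i) + F
    ≡⟨ cong (_+ F) (trans (∑<-+ n) (cong (_+ ∑< n L) (∑<-+ n))) ⟩
  ∑crossings n (nth 0 τ) + ∑< n (λ i → ∑< n (Y i)) + ∑< n L + F
    ≡⟨ cong (λ z → ∑crossings n (nth 0 τ) + z + ∑< n L + F) (trans (∑<-swap n n Y) (∑<-cong n new-upper)) ⟩
  ∑crossings n (nth 0 τ) + ∑< n Z + ∑< n L + F
    ≡⟨ trans (+-assoc (∑crossings n (nth 0 τ) + ∑< n Z) _ _) (+-assoc (∑crossings n (nth 0 τ)) _ _) ⟩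
  ∑crossings n (nth 0 τ) + (∑< n Z + (∑< n L + F))
    ≡⟨ cong (∑crossings n (nth 0 τ) +_) (trans (cong (∑< n Z +_) (sym (∑<-+ n))) (sym (∑<-+ n))) ⟩
  ∑crossings n (nth 0 τ) + ∑< n (λ i → Z i + (L i + fixed τ i * [ m ≤? i ]))
    ≡⟨ cong (∑crossings n (nth 0 τ) +_) (trans (∑<-cong n trichotomy) (∑<-interval {n} {m} n ≤-refl)) ⟩
  ∑crossings n (nth 0 τ) + (n ∸ m) ∎
  where
  open ≡-Reasoning
  v v′ : ℕ → ℕ
  v  = nth 0 τ
  v′ = nth 0 (extend m τ)
  X X′ Y : ℕ → ℕ → ℕ
  X  i j = [ crosses? (suc i) (v i) (suc j) (v j) ]
  X′ i j = [ crosses? (suc i) (v′ i) (suc j) (v′ j) ]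
  Y  i j = [ (i <? j) ×-dec (v i ≟ suc j) ×-dec (suc j <? v j) ×-dec (m ≤? j) ]
  L Z : ℕ → ℕ
  L i = [ (v i ≤? m) ×-dec (m ≤? i) ]
  Z j = [ (suc j <? v j) ×-dec (m ≤? j) ]
  F = ∑< n (λ i → fixed τ i * [ m ≤? i ])

  deficient : ∀ i → i < n → v i ≤ i → v i ≤ m
  deficient i i<n h = ≤-trans (deficient-≤ bu i i<n h) (Next-≥ bu nx)

  last-first : ∀ j → j < suc n → X′ n j ≡ 0
  last-first j (s≤s j≤n) = χ-no (crosses? (suc n) (v′ n) (suc j) (v′ j))
    λ { (inj₁ (n<j , _)) → <⇒≱ n<j (s≤s j≤n) ; (inj₂ (_ , _ , n<j)) → <⇒≱ n<j (s≤s j≤n) }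

  last-second : ∀ i → i < n → X′ i n ≡ L i
  last-second i i<n rewrite nth-extend-<′ {m = m} bu i<n | nth-extend-last′ {m = m} bu =
    χ-cong (crosses? (suc i) (punch (suc m) (v i)) (suc n) (suc m)) ((v i ≤? m) ×-dec (m ≤? i))
      (λ { (inj₁ (_ , n<a , a<m)) → ⊥-elim (<⇒≱ (<-trans n<a a<m) (s≤s (Next-≤ nx)))
         ; (inj₂ (a<m , m≤i , _)) → ≤-trans (≤-punch (suc m) (v i)) (s≤s⁻¹ a<m) , s≤s⁻¹ m≤i })
      (λ (a≤m , m≤i) → inj₂ (subst (_< suc m) (sym (punch-< (s≤s a≤m))) (s≤s a≤m) , s≤s m≤i , s≤s i<n))

  both-old : ∀ i j → i < n → j < n → X′ i j ≡ X i j + Y i j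
  both-old i j i<n j<n rewrite nth-extend-<′ {m = m} bu i<n | nth-extend-<′ {m = m} bu j<n =
    Crosses-punch {v i} {v j} (deficient j j<n)

  new-upper : ∀ j → j < n → ∑< n (λ i → Y i j) ≡ Z j
  new-upper j j<n with (suc j <? v j) ×-dec (m ≤? j)
  ... | no ¬z = trans
    (∑<-zero n λ i _ → χ-no ((i <? j) ×-dec (v i ≟ suc j) ×-dec (suc j <? v j) ×-dec (m ≤? j)) (λ (_ , _ , z) → ¬z z))
    (sym (χ-no ((suc j <? v j) ×-dec (m ≤? j)) ¬z))
  ... | yes (j<vj , m≤j) = begin
    ∑< n (λ i → Y i j)                    ≡⟨ ∑<-cong n (λ i i<n → χ-cong
        ((i <? j) ×-dec (v i ≟ suc j) ×-dec (suc j <? v j) ×-dec (m ≤? j)) (v i ≟ suc j)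
        (λ (_ , e , _) → e) (λ e → earlier i i<n e , e , j<vj , m≤j)) ⟩
    ∑< n (λ i → [ v i ≟ suc j ])          ≡⟨ ∑-values bu (λ t → [ t ≟ suc j ]) ⟩
    ∑< n (λ t → [ suc t ≟ suc j ])        ≡⟨ ∑<-cong n (λ t _ → χ-cong (suc t ≟ suc j) ((j ≤? t) ×-dec (t <? suc j))
        (λ { refl → ≤-refl , ≤-refl }) (λ { (j≤t , s≤s t≤j) → cong suc (≤-antisym t≤j j≤t) })) ⟩
    ∑< n (within j (suc j))               ≡⟨ ∑<-interval {suc j} {j} n j<n ⟩
    suc j ∸ j                             ≡⟨ m+n∸n≡m 1 j ⟩
    1                                     ≡⟨ χ-yes ((suc j <? v j) ×-dec (m ≤? j)) (j<vj , m≤j) ⟨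
    Z j                                   ∎
    where
    -- The value `suc j` cannot stand behind its own position: it would then be at most `m`,
    -- although `m ≤ j`.
    earlier : ∀ i → i < n → v i ≡ suc j → i < j
    earlier i i<n e with <-cmp i j
    ... | tri< i<j _ _ = i<j
    ... | tri≈ _ refl _ = ⊥-elim (<-irrefl (sym e) j<vj)
    ... | tri> _ _ j<i = ⊥-elim (<⇒≱ (subst (_≤ m) e (deficient i i<n (subst (_≤ i) (sym e) j<i))) m≤j)

  trichotomy : ∀ i → i < n → Z i + (L i + fixed τ i * [ m ≤? i ]) ≡ within m n i
  trichotomy i i<n with <-≤-connex i m
  ... | inj₁ i<m
    rewrite χ-no ((suc i <? v i) ×-dec (m ≤? i)) (λ (_ , h) → <⇒≱ i<m h)
          | χ-no ((v i ≤? m) ×-dec (m ≤? i)) (λ (_ , h) → <⇒≱ i<m h)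
          | χ-no (m ≤? i) (<⇒≱ i<m) | within-0ˡ {b = n} i<m = *-zeroʳ (fixed τ i)
  ... | inj₂ m≤i rewrite χ-yes (m ≤? i) m≤i | within-1 m≤i i<n with <-cmp (v i) (suc i)
  ...   | tri< vi≤i _ _
    rewrite χ-no ((suc i <? v i) ×-dec (m ≤? i)) (λ (h , _) → <-asym h vi≤i)
          | χ-yes ((v i ≤? m) ×-dec (m ≤? i)) (deficient i i<n (s≤s⁻¹ vi≤i) , m≤i)
          | χ-no (v i ≟ suc i) (<⇒≢ vi≤i) = refl
  ...   | tri≈ _ e _
    rewrite χ-no ((suc i <? v i) ×-dec (m ≤? i)) (λ (h , _) → <-irrefl (sym e) h)
          | χ-no ((v i ≤? m) ×-dec (m ≤? i)) (λ (h , _) → <⇒≱ (≤-trans (≤-reflexive (sym e)) h) m≤i)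
          | χ-yes (v i ≟ suc i) e = refl
  ...   | tri> _ _ i<vi
    rewrite χ-yes ((suc i <? v i) ×-dec (m ≤? i)) (i<vi , m≤i)
          | χ-no ((v i ≤? m) ×-dec (m ≤? i)) (λ (h , _) → <⇒≱ (<-trans (s≤s m≤i) i<vi) h)
          | χ-no (v i ≟ suc i) (>⇒≢ i<vi) = refl

∑crossings≡∑-crossingsInside : Build n B τ D Ts → ∑crossings n (nth 0 τ) ≡ ∑∈ Ts (crossingsInside n)
∑crossings≡∑-crossingsInside nil = refl
∑crossings≡∑-crossingsInside (add {n = n} {τ = τ} {m = m} {Ts = Ts} bu nx) = +-cancelʳ-≡ _ _ _ (begin
  ∑crossings (suc n) (nth 0 (extend m τ)) + ∑< n (λ i → fixed τ i * [ m ≤? i ])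
    ≡⟨ ∑crossings-extend bu nx ⟩
  ∑crossings n (nth 0 τ) + (n ∸ m)
    ≡⟨ cong (_+ (n ∸ m)) (∑crossings≡∑-crossingsInside bu) ⟩
  ∑∈ Ts (crossingsInside n) + (n ∸ m)
    ≡⟨ ∑-crossingsInside-grow bu nx ⟨
  ∑∈ ((m , 0) ∷ map (grow m) Ts) (crossingsInside (suc n)) + ∑∈ Ts (λ O → centred n O * [ m ≤? start O ])
    ≡⟨ cong (∑∈ ((m , 0) ∷ map (grow m) Ts) (crossingsInside (suc n)) +_) (∑-centred bu (λ p → [ m ≤? p ])) ⟩
  ∑∈ ((m , 0) ∷ map (grow m) Ts) (crossingsInside (suc n)) + ∑< n (λ i → fixed τ i * [ m ≤? i ]) ∎)
  where open ≡-Reasoning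

-- Crossings of the 132-avoiding permutation of a path

∑∈-++ : {A : Set} {f : A → ℕ} (xs ys : List A) → ∑∈ (xs ++ ys) f ≡ ∑∈ xs f + ∑∈ ys f
∑∈-++ [] ys = refl
∑∈-++ {f = f} (x ∷ xs) ys = trans (cong (f x +_) (∑∈-++ xs ys)) (sym (+-assoc (f x) _ _))

∑∈-concatMap : {A B : Set} {f : B → ℕ} (h : A → List B) (xs : List A) →
  ∑∈ (concatMap h xs) f ≡ ∑∈ xs (λ x → ∑∈ (h x) f)
∑∈-concatMap h [] = refl
∑∈-concatMap {f = f} h (x ∷ xs) = trans (∑∈-++ (h x) (concatMap h xs)) (cong (∑∈ (h x) f +_) (∑∈-concatMap h xs))

∑∈-applyUpTo : ∀ {A : Set} {f : A → ℕ} (h : ℕ → A) n → ∑∈ (applyUpTo h n) f ≡ ∑< n (f ∘ h)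
∑∈-applyUpTo h zero = refl
∑∈-applyUpTo {f = f} h (suc n) = trans (cong (f (h 0) +_) (∑∈-applyUpTo (h ∘ suc) n)) (sym (∑<-head n (f ∘ h)))

∑∈-oneTo : ∀ {f : ℕ → ℕ} n → ∑∈ (oneTo n) f ≡ ∑< n (f ∘ suc)
∑∈-oneTo {f} n = trans (∑∈-map (upTo n)) (∑∈-applyUpTo (λ t → t) n)

length-filterᵇ : {A : Set} (P : A → Bool) (xs : List A) → length (filterᵇ P xs) ≡ ∑∈ xs (𝟙 ∘ P)
length-filterᵇ P [] = refl
length-filterᵇ P (x ∷ xs) with P x
... | true  = cong suc (length-filterᵇ P xs)
... | false = length-filterᵇ P xs

-- Shifting the indices to start from 0 is all that is needed: the `does` of `crosses?` computes to
-- `isCrossing`.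
crs≡∑crossings : ∀ n σ → crs n σ ≡ ∑crossings n (nth 0 σ)
crs≡∑crossings n σ = begin
  crs n σ
    ≡⟨ length-filterᵇ (λ ij → isCrossing σ (proj₁ ij) (proj₂ ij)) (pairs n) ⟩
  ∑∈ (pairs n) (λ ij → 𝟙 (isCrossing σ (proj₁ ij) (proj₂ ij)))
    ≡⟨ ∑∈-concatMap (λ i → map (i ,_) (oneTo n)) (oneTo n) ⟩
  ∑∈ (oneTo n) (λ i → ∑∈ (map (i ,_) (oneTo n)) (λ ij → 𝟙 (isCrossing σ (proj₁ ij) (proj₂ ij))))
    ≡⟨ ∑∈-oneTo n ⟩
  ∑< n (λ i → ∑∈ (map (suc i ,_) (oneTo n)) (λ ij → 𝟙 (isCrossing σ (proj₁ ij) (proj₂ ij))))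
    ≡⟨ ∑<-cong n (λ i _ → trans (∑∈-map (oneTo n)) (∑∈-oneTo n)) ⟩
  ∑crossings n (nth 0 σ) ∎
  where open ≡-Reasoning

-- Values of the permutation attached to a path

nth-applyUpTo : ∀ {A : Set} {d : A} (h : ℕ → A) n → i < n → nth d (applyUpTo h n) i ≡ h i
nth-applyUpTo {zero}  h (suc n) _         = refl
nth-applyUpTo {suc i} h (suc n) (s≤s i<n) = nth-applyUpTo (h ∘ suc) n i<n

nth-map-oneTo : ∀ {A : Set} {d : A} (f : ℕ → A) n → i < n → nth d (map f (oneTo n)) i ≡ f (suc i)
nth-map-oneTo {d = d} f n i<n =
  trans (cong (λ xs → nth d xs _) (trans (cong (map f) (map-applyUpTo (λ t → t) suc n)) (map-applyUpTo suc f n)))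
        (nth-applyUpTo (f ∘ suc) n i<n)

countUp-take : ∀ D t → countUp (take t D) ≡ ups D t
countUp-take []          zero    = refl
countUp-take []          (suc t) = refl
countUp-take (c ∷ D)     zero    = refl
countUp-take (true ∷ D)  (suc t) = cong suc (countUp-take D t)
countUp-take (false ∷ D) (suc t) = countUp-take D t

countDown-take : ∀ D t → countDown (take t D) ≡ downs D t
countDown-take []          zero    = refl
countDown-take []          (suc t) = refl
countDown-take (c ∷ D)     zero    = refl
countDown-take (true ∷ D)  (suc t) = countDown-take D t
countDown-take (false ∷ D) (suc t) = cong suc (countDown-take D t)

nth-upPositions : ∀ D → p < length D → step D p ≡ true → nth 0 (upPositions D) (ups D p) ≡ p
nth-upPositions D = go D (step D) (λ t → t) λ _ → refl
  where
  -- The tail of `upTo` is `applyUpTo` of a shifted function, so the induction runs over an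
  -- arbitrary `h` through which `P` reads the steps.
  go : ∀ {p} D (P : ℕ → Bool) (h : ℕ → ℕ) → (∀ t → P (h t) ≡ step D t) → p < length D → step D p ≡ true →
       nth 0 (filterᵇ P (applyUpTo h (length D))) (ups D p) ≡ h p
  go {zero} (true ∷ D) P h e _ _ rewrite e 0 = refl
  go {suc p} (true ∷ D) P h e (s≤s p<n) u rewrite e 0 = go D P (h ∘ suc) (e ∘ suc) p<n u
  go {suc p} (false ∷ D) P h e (s≤s p<n) u rewrite e 0 = go D P (h ∘ suc) (e ∘ suc) p<n u

findᵇ-applyUpTo : (P : ℕ → Bool) (h : ℕ → ℕ) → q < n → P (h q) ≡ true → (∀ t → t < q → P (h t) ≡ false) →
  findᵇ P (applyUpTo h n) ≡ just (h q)
findᵇ-applyUpTo {zero} {suc n} P h _ e _ rewrite e = refl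
findᵇ-applyUpTo {suc q} {suc n} P h (s≤s q<n) e f rewrite f 0 (s≤s z≤n) =
  findᵇ-applyUpTo P (h ∘ suc) q<n e (λ t t<q → f (suc t) (s≤s t<q))

⊖-≡⁺ : ∀ a b c d → a + d ≡ c + b → (ℤ.+ a) ℤ.- (ℤ.+ b) ≡ (ℤ.+ c) ℤ.- (ℤ.+ d)
⊖-≡⁺ a b c d e = begin
  (ℤ.+ a) ℤ.- (ℤ.+ b)   ≡⟨ ℤ.[+m]-[+n]≡m⊖n a b ⟩
  a ℤ.⊖ b               ≡⟨ ℤ.+-cancelˡ-⊖ d a b ⟨
  (d + a) ℤ.⊖ (d + b)   ≡⟨ cong₂ ℤ._⊖_ (trans (+-comm d a) (trans e (+-comm c b))) (+-comm d b) ⟩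
  (b + c) ℤ.⊖ (b + d)   ≡⟨ ℤ.+-cancelˡ-⊖ b c d ⟩
  c ℤ.⊖ d               ≡⟨ ℤ.[+m]-[+n]≡m⊖n c d ⟨
  (ℤ.+ c) ℤ.- (ℤ.+ d)   ∎
  where open ≡-Reasoning

⊖-≡⁻ : ∀ a b c d → (ℤ.+ a) ℤ.- (ℤ.+ b) ≡ (ℤ.+ c) ℤ.- (ℤ.+ d) → a + d ≡ c + b
⊖-≡⁻ a b c d e = ℤ.+-injective (begin
  ℤ.+ (a + d)                            ≡⟨ shift a b d ⟨
  (a ℤ.⊖ b) ℤ.+ (ℤ.+ (b + d))            ≡⟨ cong (ℤ._+ (ℤ.+ (b + d))) (trans (sym (ℤ.[+m]-[+n]≡m⊖n a b)) (trans e (ℤ.[+m]-[+n]≡m⊖n c d))) ⟩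
  (c ℤ.⊖ d) ℤ.+ (ℤ.+ (b + d))            ≡⟨ cong (λ z → (c ℤ.⊖ d) ℤ.+ (ℤ.+ z)) (+-comm b d) ⟩
  (c ℤ.⊖ d) ℤ.+ (ℤ.+ (d + b))            ≡⟨ shift c d b ⟩
  ℤ.+ (c + b)                            ∎)
  where
  open ≡-Reasoning
  rearranged : ∀ x y z → x + (y + z) ≡ y + (x + z)
  rearranged = solve-∀
  shift : ∀ x y z → (x ℤ.⊖ y) ℤ.+ (ℤ.+ (y + z)) ≡ ℤ.+ (x + z)
  shift x y z = begin
    (x ℤ.⊖ y) ℤ.+ (ℤ.+ (y + z))   ≡⟨ ℤ.distribˡ-⊖-+-pos (y + z) x y ⟩
    (x + (y + z)) ℤ.⊖ y           ≡⟨ cong₂ ℤ._⊖_ (rearranged x y z) (sym (+-identityʳ y)) ⟩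
    (y + (x + z)) ℤ.⊖ (y + 0)     ≡⟨ ℤ.+-cancelˡ-⊖ y (x + z) 0 ⟩
    ℤ.+ (x + z)                   ∎

height-≡⁺ : ∀ D → D ⊢ x ≈ₕ y → height D x ≡ height D y
height-≡⁺ {x} {y} D e rewrite countUp-take D x | countDown-take D x | countUp-take D y | countDown-take D y =
  ⊖-≡⁺ (ups D x) (downs D x) (ups D y) (downs D y) e

height-≡⁻ : ∀ D → height D x ≡ height D y → D ⊢ x ≈ₕ y
height-≡⁻ {x} {y} D e rewrite countUp-take D x | countDown-take D x | countUp-take D y | countDown-take D y =
  ⊖-≡⁻ (ups D x) (downs D x) (ups D y) (downs D y) e

Closes : Path → ℕ → ℕ → Bool
Closes D p q = (p <ᵇ q) ∧ not (step D q) ∧ does (height D (suc q) ℤ.≟ height D p)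

Closes-end : Matched D p q → Closes D p q ≡ true
Closes-end {D} {p} {q} M
  rewrite dec-true (p <? q) (Matched.p<q M) | Matched.down M
        | dec-true (height D (suc q) ℤ.≟ height D p) (sym (height-≡⁺ D (Matched.level M))) = refl

Closes-before : Matched D p q → ∀ t → t < q → Closes D p t ≡ false
Closes-before {D} {p} {q} M t t<q with <-≤-connex p t
... | inj₂ t≤p rewrite dec-false (p <? t) (≤⇒≯ t≤p) = refl
... | inj₁ p<t rewrite dec-true (p <? t) p<t
    | dec-false (height D (suc t) ℤ.≟ height D p)
        (λ e → <-irrefl (height-≡⁻ {p} {suc t} D (sym e)) (Matched.above M (suc t) (m<n⇒m<1+n p<t) t<q)) = ∧-zeroʳ _

matchOf-Matched : Matched D p q → matchOf D p ≡ q
matchOf-Matched {D} {p} {q} M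
  rewrite findᵇ-applyUpTo (Closes D p) (λ t → t) (Matched.q<n M) (Closes-end M) (Closes-before M) = refl

-- An up step preceded by `ups D p` others has the label `n ∸ ups D p`, which is the index
-- `n ∸ suc (ups D p)` counted from 0; the bound keeps the subtractions from being truncated.
nth-Φinv : Matched D p q → ups D p < n →
  nth 0 (Φinv n D) (n ∸ suc (ups D p)) ≡ suc (downs D q)
nth-Φinv {D} {p} {q} {n} M u<n = begin
  nth 0 (Φinv n D) (n ∸ suc u)
    ≡⟨ nth-map-oneTo (λ i → downLabel D (matchOf D (nth 0 (upPositions D) (n ∸ i)))) n (∸-monoʳ-< {n} {suc u} {0} (s≤s z≤n) u<n) ⟩
  downLabel D (matchOf D (nth 0 (upPositions D) (n ∸ suc (n ∸ suc u))))
    ≡⟨ cong (λ k → downLabel D (matchOf D (nth 0 (upPositions D) k))) n∸[n∸u] ⟩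
  downLabel D (matchOf D (nth 0 (upPositions D) u))
    ≡⟨ cong (downLabel D ∘ matchOf D) (nth-upPositions D (<-trans p<q q<n) up) ⟩
  downLabel D (matchOf D p)
    ≡⟨ cong (downLabel D) (matchOf-Matched M) ⟩
  downLabel D q
    ≡⟨ cong suc (countDown-take D q) ⟩
  suc (downs D q) ∎
  where
  open Matched M
  open ≡-Reasoning
  u = ups D p
  n∸[n∸u] : n ∸ suc (n ∸ suc u) ≡ u
  n∸[n∸u] = trans (cong (n ∸_) (sym (+-∸-assoc 1 u<n))) (m∸[m∸n]≡n (<⇒≤ u<n))

weight-total : ∀ {w : Bool → ℕ} → w true + w false ≡ 1 → Build n B τ D Ts → weight w D (n + n) ≡ n
weight-total e nil = refl
weight-total {w = w} e (add {n = n} {D = D} {m = m} bu nx) = begin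
  weight w (insertPeak m D) (suc n + suc n)      ≡⟨ cong (weight w (insertPeak m D) ∘ suc) (+-suc n n) ⟩
  weight w (insertPeak m D) (2 + (n + n))        ≡⟨ weight-insertPeak-≥ m D (≤-length-path bu (Next-≤ nx)) (≤-trans (Next-≤ nx) (m≤m+n n n)) ⟩
  w true + w false + weight w D (n + n)          ≡⟨ cong₂ _+_ e (weight-total e bu) ⟩
  suc n                                          ∎
  where open ≡-Reasoning

weight-< : ∀ {w : Bool → ℕ} → w true + w false ≡ 1 → Build n B τ D Ts → w (step D t) ≡ 1 → t < length D → weight w D t < n
weight-< {n} {D = D} {t = t} {w = w} e bu u t<n = begin-strict
  weight w D t            <⟨ ≤-refl ⟩
  suc (weight w D t)      ≡⟨ trans (weight-suc D t<n) (trans (cong (weight w D t +_) u) (+-comm _ 1)) ⟨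
  weight w D (suc t)      ≤⟨ weight-mono D (≤-trans t<n (≤-reflexive (length-path bu))) ⟩
  weight w D (n + n)      ≡⟨ weight-total e bu ⟩
  n                       ∎
  where open ≤-Reasoning

weight-mono-< : ∀ {w : Bool → ℕ} D → w (step D x) ≡ 1 → x < length D → x < y → weight w D x < weight w D y
weight-mono-< {x} {w = w} D u x<n x<y =
  ≤-trans (≤-reflexive (sym (trans (weight-suc D x<n) (trans (cong (weight w D x +_) u) (+-comm _ 1)))))
          (weight-mono D x<y)

weight-cancel-< : ∀ {w : Bool → ℕ} D → weight w D x < weight w D y → x < y
weight-cancel-< {x} {y} D h with <-≤-connex x y
... | inj₁ x<y = x<y
... | inj₂ y≤x = ⊥-elim (<⇒≱ h (weight-mono D y≤x))

-- Write `start O` and `end O` as numbers of up steps plus down steps and add them; `level` turns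
-- the sum into twice the left side plus one. So the two ranks attached to a tunnel have a sum
-- determined by its endpoints, and with it the interval lengths counted below.
Matched-mid : ∀ O → Matched D (start O) (end O) → ups D (start O) + downs D (end O) ≡ mid O
Matched-mid {D} O@(p , ℓ) M = *-cancelˡ-≡ _ _ 2 (suc-injective (begin
  suc (2 * (xO + vO))       ≡⟨ e₁ xO vO ⟩
  (xO + suc vO) + (xO + vO)   ≡⟨ cong (λ z → xO + z + (xO + vO)) (sym downs-suc) ⟩
  xO + downs D (suc qO) + (xO + vO) ≡⟨ cong (_+ (xO + vO)) level ⟩
  ups D (suc qO) + bO + (xO + vO)   ≡⟨ cong (λ z → z + bO + (xO + vO)) ups-suc ⟩
  aO + bO + (xO + vO)         ≡⟨ e₂ aO bO xO vO ⟩
  (xO + bO) + (aO + vO)       ≡⟨ cong₂ _+_ (ups+downs D p (<⇒≤ (<-trans p<q q<n))) (ups+downs D qO (<⇒≤ q<n)) ⟩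
  p + qO                   ≡⟨ e₃ p ℓ ⟩
  suc (2 * (p + ℓ))       ∎))
  where
  open Matched M
  open ≡-Reasoning
  qO = end O
  xO = ups D p
  vO = downs D qO
  aO = ups D qO
  bO = downs D p
  downs-suc : downs D (suc qO) ≡ suc vO
  downs-suc = trans (weight-suc D q<n) (trans (cong (λ z → vO + isDown z) down) (+-comm vO 1))
  ups-suc : ups D (suc qO) ≡ aO
  ups-suc = trans (weight-suc D q<n) (trans (cong (λ z → aO + 𝟙 z) down) (+-identityʳ aO))
  e₁ : ∀ x v → suc (2 * (x + v)) ≡ (x + suc v) + (x + v)
  e₁ = solve-∀
  e₂ : ∀ a b x v → a + b + (x + v) ≡ (x + b) + (a + v)
  e₂ = solve-∀
  e₃ : ∀ p ℓ → p + suc (p + ℓ + ℓ) ≡ suc (2 * (p + ℓ))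
  e₃ = solve-∀

-- Tunnels that cross a given tunnel

tunnelCrossing : ℕ → Path → Tunnel → Tunnel → ℕ
tunnelCrossing n D I O =
  [ crosses? (n ∸ ups D (start I)) (suc (downs D (end I))) (n ∸ ups D (start O)) (suc (downs D (end O))) ]

-- A pair crosses only if the tunnel I lies inside O; then the down step of I is among the last ones inside O,
-- or its up step is among the first ones.
tunnelCrossing-split : Build n B τ D Ts → ∀ {I O} → Matched D (start I) (end I) → Matched D (start O) (end O) →
  tunnelCrossing n D I O ≡
  within (suc (ups D (start O))) ((end O ⊓ n) ∸ downs D (end O)) (ups D (start I)) +
  within ((start O ⊔ n) ∸ ups D (start O)) (downs D (end O)) (downs D (end I))
tunnelCrossing-split {n} {D = D} bu {I} {O} MI MO = χ-disjoint
  (crosses? (n ∸ xI) (suc vI) (n ∸ xO) (suc vO))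
  ((suc xO ≤? xI) ×-dec (xI <? (qO ⊓ n) ∸ vO))
  (((pO ⊔ n) ∸ xO ≤? vI) ×-dec (vI <? vO))
  split fromLower fromUpper disjoint
  where
  module I = Matched MI
  module O = Matched MO
  pO = start O
  qO = end O
  pI = start I
  qI = end I
  xO = ups D pO
  vO = downs D qO
  xI = ups D pI
  vI = downs D qI
  Lower Upper : Set
  -- The minimum unites two bounds: the up step of `I` precedes `qO`, that is,
  -- `xI < ups D qO = qO ∸ vO`, and the crossing inequality is `xI + vO < n`. Dually, the maximum in
  -- `Upper` unites `downs D pO ≤ vI` with `n ≤ xO + vI`.
  Lower = suc xO ≤ xI × xI < (qO ⊓ n) ∸ vO
  Upper = (pO ⊔ n) ∸ xO ≤ vI × vI < vO
  pI<D : pI < length D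
  pI<D = <-trans I.p<q I.q<n
  pO<D : pO < length D
  pO<D = <-trans O.p<q O.q<n
  xI<n : xI < n
  xI<n = weight-< refl bu (cong 𝟙 I.up) pI<D
  vO<n : vO < n
  vO<n = weight-< refl bu (cong isDown O.down) O.q<n
  x+b : xO + downs D pO ≡ pO
  x+b = ups+downs D pO (<⇒≤ pO<D)
  a+v : ups D qO + vO ≡ qO
  a+v = ups+downs D qO (<⇒≤ O.q<n)
  vO≤q⊓n : vO ≤ qO ⊓ n
  vO≤q⊓n = ⊓-glb (≤-trans (m≤n+m vO _) (≤-reflexive a+v)) (<⇒≤ vO<n)

  split : Crosses (n ∸ xI) (suc vI) (n ∸ xO) (suc vO) → Lower ⊎ Upper
  split (inj₁ (i<j , j≤vI , s≤s vI<vO)) = inj₂ (m≤n+o⇒m∸n≤o (pO ⊔ n) xO (⊔-lub pO≤ n≤) , vI<vO)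
    where
    -- Labels of up steps decrease along the path, so the smaller label belongs to the tunnel
    -- starting further right.
    pO<pI : pO < pI
    pO<pI = weight-cancel-< D (∸-cancelʳ-< i<j)
    pO≤ : pO ≤ xO + vI
    pO≤ = ≤-trans (≤-reflexive (sym x+b)) (+-monoʳ-≤ xO (weight-mono D (<⇒≤ (<-trans pO<pI I.p<q))))
    n≤ : n ≤ xO + vI
    n≤ = ≤-trans (m≤n+m∸n n xO) (+-monoʳ-≤ xO (s≤s⁻¹ j≤vI))
  split (inj₂ (s≤s vI<vO , vO<i , i<j)) = inj₁ (∸-cancelʳ-< i<j , m+n≤o⇒m≤o∸n (suc xI) (⊓-glb q≥ n≥))
    where
    q≥ : suc xI + vO ≤ qO
    q≥ = ≤-trans (+-monoˡ-≤ vO (weight-mono-< D (cong 𝟙 I.up) pI<D (<-trans I.p<q (weight-cancel-< D vI<vO))))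
                 (≤-reflexive a+v)
    n≥ : suc xI + vO ≤ n
    n≥ = ≤-trans (≤-reflexive (cong suc (+-comm xI vO))) (m≤o∸n⇒m+n≤o (suc vO) (<⇒≤ xI<n) vO<i)

  fromLower : Lower → Crosses (n ∸ xI) (suc vI) (n ∸ xO) (suc vO)
  fromLower (xO<xI , h) = inj₂ (s≤s vI<vO , m+n≤o⇒m≤o∸n (suc vO) vO+xI<n , ∸-monoʳ-< xO<xI (<⇒≤ xI<n))
    where
    xI+vO< : suc xI + vO ≤ qO ⊓ n
    xI+vO< = m≤o∸n⇒m+n≤o (suc xI) vO≤q⊓n h
    vO+xI<n : suc vO + xI ≤ n
    vO+xI<n = ≤-trans (≤-reflexive (cong suc (+-comm vO xI))) (≤-trans xI+vO< (m⊓n≤n qO n))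
    pI<qO : pI < qO
    pI<qO = weight-cancel-< D (+-cancelʳ-≤ vO (suc xI) (ups D qO)
              (≤-trans xI+vO< (≤-trans (m⊓n≤m qO n) (≤-reflexive (sym a+v)))))
    vI<vO : vI < vO
    vI<vO = weight-mono-< D (cong isDown I.down) I.q<n
              (Matched-nested MO MI (weight-cancel-< D xO<xI) pI<qO)

  fromUpper : Upper → Crosses (n ∸ xI) (suc vI) (n ∸ xO) (suc vO)
  fromUpper (h , vI<vO) = inj₁ (∸-monoʳ-< xO<xI (<⇒≤ xI<n) , s≤s (m≤n+o⇒m∸n≤o n xO (≤-trans (m≤n⊔m pO n) bound)) , s≤s vI<vO)
    where
    bound : pO ⊔ n ≤ xO + vI
    bound = ≤-trans (m≤n+m∸n (pO ⊔ n) xO) (+-monoʳ-≤ xO h)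
    b≤vI : downs D pO ≤ vI
    b≤vI = +-cancelˡ-≤ xO _ _ (≤-trans (≤-reflexive x+b) (≤-trans (m≤m⊔n pO n) bound))
    pO<qI : pO < qI
    pO<qI with <-cmp pO qI
    ... | tri< pO<qI _ _ = pO<qI
    ... | tri≈ _ e _ with () ← trans (sym O.up) (trans (cong (step D) e) I.down)
    ... | tri> _ _ qI<pO = ⊥-elim (<⇒≱ (weight-mono-< D (cong isDown I.down) I.q<n qI<pO) b≤vI)
    xO<xI : xO < xI
    xO<xI = weight-mono-< D (cong 𝟙 O.up) pO<D (Matched-nested⁻¹ MO MI pO<qI (weight-cancel-< D vI<vO))

  disjoint : Lower → ¬ Upper
  disjoint (xO<xI , h) (h′ , vI<vO) = <-irrefl refl (begin-strict
    n         ≤⟨ m≤n⊔m pO n ⟩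
    pO ⊔ n    ≤⟨ m≤n+m∸n (pO ⊔ n) xO ⟩
    xO + ((pO ⊔ n) ∸ xO) ≤⟨ +-monoʳ-≤ xO h′ ⟩
    xO + vI   <⟨ +-mono-< xO<xI vI<vO ⟩
    xI + vO   <⟨ m≤o∸n⇒m+n≤o (suc xI) vO≤q⊓n h ⟩
    qO ⊓ n    ≤⟨ m⊓n≤n qO n ⟩
    n         ∎)
    where open ≤-Reasoning

-- Since the ranks of the up steps and those of the down steps each run through all numbers below
-- `n`, both conditions count whole intervals, and `Matched-mid` expresses their lengths by the
-- endpoints of `O`.
∑-tunnelCrossing : Build n B τ D Ts → ∀ {O} → Matched D (start O) (end O) →
  ∑∈ Ts (λ I → tunnelCrossing n D I O) ≡ crossingsInside n O
∑-tunnelCrossing {n} {D = D} {Ts = Ts} bu {O} MO = begin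
  ∑∈ Ts (λ I → tunnelCrossing n D I O)
    ≡⟨ ∑∈-cong (All-map (λ MI → tunnelCrossing-split bu MI MO) (tunnels-matched bu)) ⟩
  ∑∈ Ts (λ I → within (suc xO) ((qO ⊓ n) ∸ vO) (ups D (start I)) + within ((pO ⊔ n) ∸ xO) vO (downs D (end I)))
    ≡⟨ ∑∈-+ Ts ⟩
  ∑∈ Ts (within (suc xO) ((qO ⊓ n) ∸ vO) ∘ ups D ∘ start) + ∑∈ Ts (within ((pO ⊔ n) ∸ xO) vO ∘ downs D ∘ end)
    ≡⟨ cong₂ _+_ (∑-starts bu _) (∑-ends bu _) ⟩
  ∑< n (within (suc xO) ((qO ⊓ n) ∸ vO)) + ∑< n (within ((pO ⊔ n) ∸ xO) vO)
    ≡⟨ cong₂ _+_ (∑<-interval {(qO ⊓ n) ∸ vO} {suc xO} n (≤-trans (m∸n≤m _ vO) (m⊓n≤n qO n)))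
                 (∑<-interval {vO} {(pO ⊔ n) ∸ xO} n (<⇒≤ (weight-< refl bu (cong isDown O.down) O.q<n))) ⟩
  (((qO ⊓ n) ∸ vO) ∸ suc xO) + (vO ∸ ((pO ⊔ n) ∸ xO))
    ≡⟨ cong₂ _+_ lower upper ⟩
  crossingsInside n O ∎
  where
  open ≡-Reasoning
  module O = Matched MO
  pO = start O
  qO = end O
  xO = ups D pO
  vO = downs D qO
  xO≤pO⊔n : xO ≤ pO ⊔ n
  xO≤pO⊔n = ≤-trans (≤-trans (m≤m+n xO _) (≤-reflexive (ups+downs D pO (<⇒≤ (<-trans O.p<q O.q<n))))) (m≤m⊔n pO n)
  lower : ((qO ⊓ n) ∸ vO) ∸ suc xO ≡ (qO ⊓ n) ∸ suc (mid O)
  lower = trans (∸-+-assoc (qO ⊓ n) vO (suc xO))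
    (cong ((qO ⊓ n) ∸_) (trans (+-suc vO xO) (cong suc (trans (+-comm vO xO) (Matched-mid O MO)))))
  upper : vO ∸ ((pO ⊔ n) ∸ xO) ≡ mid O ∸ (pO ⊔ n)
  upper = trans (sym ([m+n]∸[m+o]≡n∸o xO vO _)) (cong₂ _∸_ (Matched-mid O MO) (m+[n∸m]≡n xO≤pO⊔n))

crs-Φinv : Build n B τ D Ts → crs n (Φinv n D) ≡ ∑∈ Ts (crossingsInside n)
crs-Φinv {n} {D = D} {Ts = Ts} bu = begin
  crs n (Φinv n D)
    ≡⟨ crs≡∑crossings n (Φinv n D) ⟩
  ∑< n (λ i → ∑< n (λ j → [ crosses? (suc i) (ρ i) (suc j) (ρ j) ]))
    -- Up steps are labelled from `n` downwards; after the reversal `x` is the number of up steps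
    -- preceding the one in question.
    ≡⟨ ∑<-reverse n _ ⟩
  ∑< n (λ x → ∑< n (λ j → [ crosses? (suc (n ∸ suc x)) (ρ (n ∸ suc x)) (suc j) (ρ j) ]))
    ≡⟨ ∑<-cong n (λ x _ → ∑<-reverse n _) ⟩
  ∑< n (λ x → ∑< n (G x))
    ≡⟨ ∑<-swap n n G ⟩
  ∑< n (λ y → ∑< n (λ x → G x y))
    ≡⟨ ∑-starts bu _ ⟨
  ∑∈ Ts (λ O → ∑< n (λ x → G x (ups D (start O))))
    ≡⟨ ∑∈-cong (All-map (λ {O} MO → trans (sym (∑-starts bu (λ x → G x (ups D (start O)))))
         (trans (∑∈-cong (All-map (λ MI → labels MI MO) (tunnels-matched bu))) (∑-tunnelCrossing bu MO))) (tunnels-matched bu)) ⟩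
  ∑∈ Ts (crossingsInside n) ∎
  where
  open ≡-Reasoning
  ρ : ℕ → ℕ
  ρ = nth 0 (Φinv n D)
  G : ℕ → ℕ → ℕ
  G x y = [ crosses? (suc (n ∸ suc x)) (ρ (n ∸ suc x)) (suc (n ∸ suc y)) (ρ (n ∸ suc y)) ]
  labels : ∀ {I O} → Matched D (start I) (end I) → Matched D (start O) (end O) →
    G (ups D (start I)) (ups D (start O)) ≡ tunnelCrossing n D I O
  labels {I} {O} MI MO = cong₂ (λ (i , a) (j , b) → [ crosses? i a j b ]) (label MI) (label MO)
    where
    label : ∀ {p q} → Matched D p q →
      (suc (n ∸ suc (ups D p)) , ρ (n ∸ suc (ups D p))) ≡ (n ∸ ups D p , suc (downs D q))
    label {p} M = cong₂ _,_ (sym (+-∸-assoc 1 x<n)) (nth-Φinv M x<n)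
      where
      x<n : ups D p < n
      x<n = weight-< refl bu (cong 𝟙 (Matched.up M)) (<-trans (Matched.p<q M) (Matched.q<n M))

-- Robinson–Schensted tableaux and the path Ψ

rowIns-append : ∀ {r} → All (_≤ x) r → rowIns x r ≡ (nothing , r ++ x ∷ [])
rowIns-append [] = refl
rowIns-append {x} {y ∷ r} (y≤x ∷ ys≤x) rewrite dec-false (x <? y) (≤⇒≯ y≤x) | rowIns-append ys≤x = refl

rowIns-bump : ∀ {r s} → All (_≤ x) r → x < y → rowIns x (r ++ y ∷ s) ≡ (just y , r ++ x ∷ s)
rowIns-bump {x} {y} [] x<y rewrite dec-true (x <? y) x<y = refl
rowIns-bump {x} {r = z ∷ r} (z≤x ∷ zs≤x) x<y rewrite dec-false (x <? z) (≤⇒≯ z≤x) =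
  cong (λ (o , l) → o , z ∷ l) (rowIns-bump zs≤x x<y)

module _ (g : ℕ → ℕ) (g-<ᵇ : (x y : ℕ) → (g x <ᵇ g y) ≡ (x <ᵇ y)) where

  rowIns-map : ∀ x r → rowIns (g x) (map g r) ≡ (Maybe-map g (proj₁ (rowIns x r)) , map g (proj₂ (rowIns x r)))
  rowIns-map x [] = refl
  rowIns-map x (y ∷ r) rewrite g-<ᵇ x y with x <ᵇ y
  ... | true  = refl
  ... | false rewrite rowIns-map x r = refl

  ins-map : ∀ x T → ins (g x) (map (map g) T) ≡ (map (map g) (proj₁ (ins x T)) , proj₂ (ins x T))
  ins-map x [] = refl
  ins-map x (r ∷ T) with rowIns (g x) (map g r) | rowIns x r | rowIns-map x r
  ... | _ | nothing , r′ | refl = refl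
  ... | _ | just y  , r′ | refl rewrite ins-map y T = refl

  -- The algorithm only compares entries, so an order-preserving relabelling passes through it and
  -- leaves the recording tableau unchanged.
  rskGo-map : ∀ t xs P Q → rskGo t (map g xs) (map (map g) P , Q) ≡
    (map (map g) (proj₁ (rskGo t xs (P , Q))) , proj₂ (rskGo t xs (P , Q)))
  rskGo-map t []       P Q = refl
  rskGo-map t (x ∷ xs) P Q rewrite ins-map x P = rskGo-map (suc t) xs _ _

rskGo-++ : ∀ t xs ys PQ → rskGo t (xs ++ ys) PQ ≡ rskGo (t + length xs) ys (rskGo t xs PQ)
rskGo-++ t []       ys PQ      rewrite +-identityʳ t = refl
rskGo-++ t (x ∷ xs) ys (P , Q) rewrite +-suc t (length xs) = rskGo-++ (suc t) xs ys _

punch-<ᵇ : ∀ a x y → (punch a x <ᵇ punch a y) ≡ (x <ᵇ y)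
punch-<ᵇ a x y with x <? y
... | yes x<y rewrite dec-true (x <? y) x<y = dec-true (punch a x <? punch a y) (punch-mono-< a x<y)
... | no x≮y rewrite dec-false (x <? y) x≮y = dec-false (punch a x <? punch a y) (x≮y ∘ punch-cancel-< a)

RSK-extend : ∀ m τ {P Q} → RSK τ ≡ (P , Q) →
  let P′ , k = ins (suc m) (map (map (punch (suc m))) P) in
  RSK (extend m τ) ≡ (P′ , addAt (suc (length τ)) k Q)
RSK-extend m τ {P} {Q} e
  rewrite rskGo-++ 1 (map (punch (suc m)) τ) (suc m ∷ []) ([] , [])
        | length-map (punch (suc m)) τ
        | rskGo-map (punch (suc m)) (punch-<ᵇ (suc m)) 1 τ [] []
        | e = refl

-- Empty trailing rows are left out, as in the tableaux that `ins` builds, so that equalities with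
-- the output of `RSK` are literal.
twoRows : List ℕ → List ℕ → Tableau
twoRows r       (y ∷ s) = r ∷ (y ∷ s) ∷ []
twoRows []      []      = []
twoRows (x ∷ r) []      = (x ∷ r) ∷ []

row₀-twoRows : ∀ r s → row 0 (twoRows r s) ≡ r
row₀-twoRows r       (y ∷ s) = refl
row₀-twoRows []      []      = refl
row₀-twoRows (x ∷ r) []      = refl

row₁-twoRows : ∀ r s → row 1 (twoRows r s) ≡ s
row₁-twoRows r       (y ∷ s) = refl
row₁-twoRows []      []      = refl
row₁-twoRows (x ∷ r) []      = refl

map-twoRows : ∀ g r s → map (map g) (twoRows r s) ≡ twoRows (map g r) (map g s)
map-twoRows g r       (y ∷ s) = refl
map-twoRows g []      []      = refl
map-twoRows g (x ∷ r) []      = refl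

addAt₀-twoRows : ∀ v r s → addAt v 0 (twoRows r s) ≡ twoRows (r ++ v ∷ []) s
addAt₀-twoRows v r       (y ∷ s) = refl
addAt₀-twoRows v []      []      = refl
addAt₀-twoRows v (x ∷ r) []      = refl

addAt₁-twoRows : ∀ v r s → addAt v 1 (twoRows r s) ≡ twoRows r (s ++ v ∷ [])
addAt₁-twoRows v r       (y ∷ s) = refl
addAt₁-twoRows v []      []      = refl
addAt₁-twoRows v (x ∷ r) []      = refl

ins-twoRows-append : ∀ {x r} s → All (_≤ x) r → ins x (twoRows r s) ≡ (twoRows (r ++ x ∷ []) s , 0)
ins-twoRows-append {r = []}    []      _ = refl
ins-twoRows-append {r = z ∷ r} []      h rewrite rowIns-append h = refl
ins-twoRows-append {r = []}    (y ∷ s) h rewrite rowIns-append h = refl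
ins-twoRows-append {r = z ∷ r} (y ∷ s) h rewrite rowIns-append h = refl

ins-twoRows-bump : ∀ {x y r r′} s → All (_≤ x) r → x < y → All (_≤ y) s →
  ins x (twoRows (r ++ y ∷ r′) s) ≡ (twoRows (r ++ x ∷ r′) (s ++ y ∷ []) , 1)
ins-twoRows-bump {r = []} {r′} [] h x<y h′ rewrite rowIns-bump {s = r′} h x<y = refl
ins-twoRows-bump {r = z ∷ r} {r′} [] h x<y h′ rewrite rowIns-bump {s = r′} h x<y = refl
ins-twoRows-bump {r = r} {r′} (w ∷ s) h x<y h′ rewrite rowIns-bump {s = r′} h x<y | rowIns-append h′ = refl

-- Words of steps as two-row tableaux

places : Bool → ℕ → Path → List ℕ
places c     t []          = []
places true  t (true ∷ w)  = t ∷ places true (suc t) w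
places true  t (false ∷ w) = places true (suc t) w
places false t (true ∷ w)  = places false (suc t) w
places false t (false ∷ w) = t ∷ places false (suc t) w

places-++ : ∀ c t u w → places c t (u ++ w) ≡ places c t u ++ places c (t + length u) w
places-++ c     t []          w rewrite +-identityʳ t = refl
places-++ true  t (true ∷ u)  w rewrite +-suc t (length u) = cong (t ∷_) (places-++ true (suc t) u w)
places-++ true  t (false ∷ u) w rewrite +-suc t (length u) = places-++ true (suc t) u w
places-++ false t (true ∷ u)  w rewrite +-suc t (length u) = places-++ false (suc t) u w
places-++ false t (false ∷ u) w rewrite +-suc t (length u) = cong (t ∷_) (places-++ false (suc t) u w)

places-≥ : ∀ c t w → All (t ≤_) (places c t w)
places-≥ c     t []          = []
places-≥ true  t (true ∷ w)  = ≤-refl ∷ All-map <⇒≤ (places-≥ true (suc t) w)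
places-≥ true  t (false ∷ w) = All-map <⇒≤ (places-≥ true (suc t) w)
places-≥ false t (true ∷ w)  = All-map <⇒≤ (places-≥ false (suc t) w)
places-≥ false t (false ∷ w) = ≤-refl ∷ All-map <⇒≤ (places-≥ false (suc t) w)

places-< : ∀ c t w → All (_< t + length w) (places c t w)
places-< c     t []          = []
places-< true  t (true ∷ w)  rewrite +-suc t (length w) = s≤s (m≤m+n t _) ∷ places-< true (suc t) w
places-< true  t (false ∷ w) rewrite +-suc t (length w) = places-< true (suc t) w
places-< false t (true ∷ w)  rewrite +-suc t (length w) = places-< false (suc t) w
places-< false t (false ∷ w) rewrite +-suc t (length w) = s≤s (m≤m+n t _) ∷ places-< false (suc t) w

places-none : ∀ c t k → places c t (replicate k (not c)) ≡ []
places-none c     t zero    = refl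
places-none true  t (suc k) = places-none true (suc t) k
places-none false t (suc k) = places-none false (suc t) k

map-punch-places : ∀ c t w → a ≤ t → map (punch a) (places c t w) ≡ places c (suc t) w
map-punch-places c     t []          h = refl
map-punch-places true  t (true ∷ w)  h = cong₂ _∷_ (punch-≥ h) (map-punch-places true (suc t) w (m≤n⇒m≤1+n h))
map-punch-places true  t (false ∷ w) h = map-punch-places true (suc t) w (m≤n⇒m≤1+n h)
map-punch-places false t (true ∷ w)  h = map-punch-places false (suc t) w (m≤n⇒m≤1+n h)
map-punch-places false t (false ∷ w) h = cong₂ _∷_ (punch-≥ h) (map-punch-places false (suc t) w (m≤n⇒m≤1+n h))

-- Raising opens a gap at `suc (length A)`, the place of a letter to be put between `A` and `w`.
map-punch-places-++ : ∀ c A w → map (punch (suc (length A))) (places c 1 (A ++ w)) ≡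
  places c 1 A ++ places c (2 + length A) w
map-punch-places-++ c A w = begin
  map raise (places c 1 (A ++ w))                                ≡⟨ cong (map raise) (places-++ c 1 A w) ⟩
  map raise (places c 1 A ++ places c (1 + length A) w)          ≡⟨ map-++ raise (places c 1 A) _ ⟩
  map raise (places c 1 A) ++ map raise (places c (1 + length A) w)
    ≡⟨ cong₂ _++_ (map-id-local (All-map punch-< (places-< c 1 A))) (map-punch-places c (suc (length A)) w ≤-refl) ⟩
  places c 1 A ++ places c (2 + length A) w                  ∎
  where
  open ≡-Reasoning
  raise = punch (suc (length A))

-- An up step marks the first row of the insertion tableau but the second row of the recording
-- tableau, as in the definition of `Ψ`.
insertionTableau recordingTableau : Path → Tableau
insertionTableau w = twoRows (places true 1 w) (places false 1 w)
recordingTableau y = twoRows (places false 1 y) (places true 1 y)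

addAt-recording : ∀ c y → addAt (suc (length y)) (𝟙 c) (recordingTableau y) ≡ recordingTableau (y ++ c ∷ [])
addAt-recording false y rewrite places-++ false 1 y (false ∷ []) | places-++ true 1 y (false ∷ []) | ++-identityʳ (places true 1 y) =
  addAt₀-twoRows (suc (length y)) (places false 1 y) (places true 1 y)
addAt-recording true y rewrite places-++ false 1 y (true ∷ []) | places-++ true 1 y (true ∷ []) | ++-identityʳ (places false 1 y) =
  addAt₁-twoRows (suc (length y)) (places false 1 y) (places true 1 y)

falls rises : ℕ → Path
falls a = replicate a false
rises b = replicate b true

-- What remains of falls a ++ rises b after a smaller value is inserted: the first rise, if any, is bumped.
bumpedTail : ℕ → ℕ → Path
bumpedTail a zero    = falls a
bumpedTail a (suc b) = falls a ++ false ∷ rises b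

bumps : ℕ → Bool
bumps zero    = false
bumps (suc b) = true

replicate-shift : ∀ {A : Set} k (c : A) xs → replicate k c ++ c ∷ xs ≡ c ∷ replicate k c ++ xs
replicate-shift zero    c xs = refl
replicate-shift (suc k) c xs = cong (c ∷_) (replicate-shift k c xs)

All-≤-places : ∀ c A → All (_≤ suc (length A)) (places c 1 A)
All-≤-places c A = All-map <⇒≤ (places-< c 1 A)

-- First-row entries from `A` are not larger than the inserted value, and the next one in that row
-- is the first rise; so this rise is bumped. All second-row entries precede it, as only rises
-- follow, so it is appended there and turns into a fall. Without rises the value is appended to the
-- first row.
ins-insertionTableau : ∀ A a b → let f = punch (suc (length A)) in
  ins (suc (length A)) (map (map f) (insertionTableau (A ++ falls a ++ rises b))) ≡
  (insertionTableau (A ++ true ∷ bumpedTail a b) , 𝟙 (bumps b))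
ins-insertionTableau A a zero
  rewrite ++-identityʳ (falls a)
        | map-twoRows (punch (suc (length A))) (places true 1 (A ++ falls a)) (places false 1 (A ++ falls a))
        | map-punch-places-++ true A (falls a)
        | map-punch-places-++ false A (falls a)
        | places-++ true 1 A (true ∷ falls a)
        | places-++ false 1 A (true ∷ falls a)
        | places-none true (2 + length A) a
        | ++-identityʳ (places true 1 A) =
  ins-twoRows-append _ (All-≤-places true A)
ins-insertionTableau A a (suc b)
  rewrite map-twoRows (punch (suc (length A))) (places true 1 (A ++ falls a ++ rises (suc b))) (places false 1 (A ++ falls a ++ rises (suc b)))
        | map-punch-places-++ true A (falls a ++ rises (suc b))
        | map-punch-places-++ false A (falls a ++ rises (suc b))
        | places-++ true 1 A (true ∷ falls a ++ false ∷ rises b)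
        | places-++ false 1 A (true ∷ falls a ++ false ∷ rises b)
        | places-++ true (2 + length A) (falls a) (true ∷ rises b)
        | places-++ false (2 + length A) (falls a) (true ∷ rises b)
        | places-++ true (2 + length A) (falls a) (false ∷ rises b)
        | places-++ false (2 + length A) (falls a) (false ∷ rises b)
        | length-replicate a {false}
        | places-none true (2 + length A) a
        | places-none false (3 + (length A + a)) b
        | ++-identityʳ (places false (2 + length A) (falls a)) =
  trans (ins-twoRows-bump (places false 1 A ++ places false (2 + length A) (falls a)) (All-≤-places true A) (s≤s (s≤s (m≤m+n _ a)))
          (All.++⁺ (All-map (λ h → ≤-trans h (m≤n⇒m≤1+n (s≤s (m≤m+n _ a)))) (All-≤-places false A))
                   (subst (λ z → All (_≤ 2 + length A + z) (places false (2 + length A) (falls a))) (length-replicate a) (All-map <⇒≤ (places-< false (2 + length A) (falls a))))))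
        (cong (λ z → twoRows (places true 1 A ++ suc (length A) ∷ places true (3 + (length A + a)) (rises b)) z , 1) (++-assoc (places false 1 A) _ _))

bumpedTail-split : ∀ a b → ∃[ a′ ] ∃[ b′ ] bumpedTail a b ≡ falls a′ ++ rises b′
bumpedTail-split a zero    = a , 0 , sym (++-identityʳ (falls a))
bumpedTail-split a (suc b) = suc a , b , replicate-shift a false (rises b)

insertPeak-++ : ∀ A z → insertPeak (length A) (A ++ z) ≡ A ++ true ∷ false ∷ z
insertPeak-++ []      z = refl
insertPeak-++ (c ∷ A) z = cong (c ∷_) (insertPeak-++ A z)

-- Equal steps commute: the down step of the peak slides through the falls to the place of the
-- bumped rise, and the rises give up their last step to the second half. Without rises the down
-- step slides into the second half itself. This is where the shape of the tail behind the peak is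
-- used.
bumpedTail-bumps : ∀ a b z → bumpedTail a b ++ bumps b ∷ z ≡ false ∷ (falls a ++ rises b) ++ z
bumpedTail-bumps a zero z rewrite ++-identityʳ (falls a) = replicate-shift a false z
bumpedTail-bumps a (suc b) z = begin
  (falls a ++ false ∷ rises b) ++ true ∷ z   ≡⟨ ++-assoc (falls a) _ _ ⟩
  falls a ++ false ∷ rises b ++ true ∷ z     ≡⟨ replicate-shift a false _ ⟩
  false ∷ falls a ++ rises b ++ true ∷ z     ≡⟨ cong (λ l → false ∷ falls a ++ l) (replicate-shift b true z) ⟩
  false ∷ falls a ++ (true ∷ rises b) ++ z   ≡⟨ cong (false ∷_) (++-assoc (falls a) (true ∷ rises b) z) ⟨
  false ∷ (falls a ++ true ∷ rises b) ++ z   ∎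
  where open ≡-Reasoning

falls-rises-split : ∀ k a b → k ≤ a + b →
  ∃[ C ] ∃[ a′ ] ∃[ b′ ] (length C ≡ k × falls a ++ rises b ≡ C ++ falls a′ ++ rises b′)
falls-rises-split zero    a       b       _ = [] , a , b , refl , refl
falls-rises-split (suc k) (suc a) b       (s≤s h) with falls-rises-split k a b h
... | C , a′ , b′ , e , e′ = false ∷ C , a′ , b′ , cong suc e , cong (false ∷_) e′
falls-rises-split (suc k) zero    (suc b) (s≤s h) with falls-rises-split k zero b h
... | C , a′ , b′ , e , e′ = true ∷ C , a′ , b′ , cong suc e , cong (true ∷_) e′

record Tableaux (τ : List ℕ) (D w y : Path) : Set where
  field
    rsk  : RSK τ ≡ (insertionTableau w , recordingTableau y)
    path : D ≡ w ++ reverse y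

Tableaux-extend : ∀ A a b {y} → length τ ≡ length y → Tableaux τ D (A ++ falls a ++ rises b) y →
  Tableaux (extend (length A) τ) (insertPeak (length A) D) (A ++ true ∷ bumpedTail a b) (y ++ bumps b ∷ [])
Tableaux-extend {τ} {D} A a b {y} lτ T = record { rsk = rsk′ ; path = path′ }
  where
  open Tableaux T
  open ≡-Reasoning
  rsk′ : RSK (extend (length A) τ) ≡ (insertionTableau (A ++ true ∷ bumpedTail a b) , recordingTableau (y ++ bumps b ∷ []))
  rsk′ rewrite RSK-extend (length A) τ rsk | ins-insertionTableau A a b | lτ | addAt-recording (bumps b) y = refl
  path′ : insertPeak (length A) D ≡ (A ++ true ∷ bumpedTail a b) ++ reverse (y ++ bumps b ∷ [])
  path′ = begin
    insertPeak (length A) D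
      ≡⟨ cong (insertPeak (length A)) (trans path (++-assoc A _ _)) ⟩
    insertPeak (length A) (A ++ (falls a ++ rises b) ++ reverse y)
      ≡⟨ insertPeak-++ A _ ⟩
    A ++ true ∷ false ∷ (falls a ++ rises b) ++ reverse y
      ≡⟨ cong (λ z → A ++ true ∷ z) (bumpedTail-bumps a b (reverse y)) ⟨
    A ++ true ∷ bumpedTail a b ++ bumps b ∷ reverse y
      ≡⟨ ++-assoc A _ _ ⟨
    (A ++ true ∷ bumpedTail a b) ++ bumps b ∷ reverse y
      ≡⟨ cong ((A ++ true ∷ bumpedTail a b) ++_) (reverse-++ y (bumps b ∷ [])) ⟨
    (A ++ true ∷ bumpedTail a b) ++ reverse (y ++ bumps b ∷ []) ∎

length-bumpedTail : ∀ a b → length (bumpedTail a b) ≡ length (falls a ++ rises b)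
length-bumpedTail a zero    = cong length (sym (++-identityʳ (falls a)))
length-bumpedTail a (suc b) = same a
  where
  same : ∀ a → length (falls a ++ false ∷ rises b) ≡ length (falls a ++ true ∷ rises b)
  same zero    = refl
  same (suc a) = cong suc (same a)

length-∷ʳ : ∀ {A : Set} (xs : List A) x → length (xs ++ x ∷ []) ≡ suc (length xs)
length-∷ʳ xs x = trans (length-++ xs) (+-comm (length xs) 1)

-- Every later peak goes to a position `m ≥ B`, so what lies between it and the middle is again
-- falls followed by rises, the shape that row insertion needs.
record Halves (n B : ℕ) (τ : List ℕ) (D : Path) : Set where
  field
    {prefix times} : Path
    {α β}      : ℕ
    length-prefix   : length prefix ≡ B
    length-w   : length (prefix ++ falls α ++ rises β) ≡ n
    length-times   : length times ≡ n
    tableaux   : Tableaux τ D (prefix ++ falls α ++ rises β) times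

halves : Build n B τ D Ts → Halves n B τ D
halves nil = record
  { prefix = [] ; times = [] ; α = 0 ; β = 0
  ; length-prefix = refl ; length-w = refl ; length-times = refl ; tableaux = record { rsk = refl ; path = refl } }
halves (add {n = n} {τ = τ} {D = D} bu top) = record
  { prefix = prefix ; times = times ++ false ∷ [] ; α = α ; β = suc β
  ; length-prefix = length-prefix
  ; length-w = trans (cong length (sym w′)) (trans (length-∷ʳ w true) (cong suc length-w))
  ; length-times = trans (length-∷ʳ times false) (cong suc length-times)
  -- A new maximum puts the peak at the end of the first half, so the tail behind it is empty and
  -- nothing is bumped.
  ; tableaux = subst₂ (λ m w → Tableaux (extend m τ) (insertPeak m D) w (times ++ false ∷ [])) length-w w′
      (Tableaux-extend w 0 0 (trans (length-perm bu) (sym length-times))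
        (subst (λ u → Tableaux τ D u times) (sym (++-identityʳ w)) tableaux))
  }
  where
  open Halves (halves bu)
  w : Path
  w = prefix ++ falls α ++ rises β
  w′ : w ++ true ∷ [] ≡ prefix ++ falls α ++ rises (suc β)
  w′ = trans (++-assoc prefix _ _) (cong (prefix ++_) (trans (++-assoc (falls α) _ _)
         (cong (falls α ++_) (trans (replicate-shift β true []) (cong (true ∷_) (++-identityʳ (rises β)))))))
halves (add {n = n} {B = B} {τ = τ} {D = D} {m = m} bu (low B≤m m<n)) with halves bu
... | H with falls-rises-split (m ∸ B) (Halves.α H) (Halves.β H) m∸B≤
  where
  open Halves H
  m∸B≤ : m ∸ B ≤ α + β
  m∸B≤ = m≤n+o⇒m∸n≤o m B (≤-trans (<⇒≤ m<n) (≤-reflexive (begin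
    n                                          ≡⟨ length-w ⟨
    length (prefix ++ falls α ++ rises β)      ≡⟨ length-++ prefix ⟩
    length prefix + length (falls α ++ rises β)     ≡⟨ cong₂ _+_ length-prefix (length-++ (falls α)) ⟩
    B + (length (falls α) + length (rises β))  ≡⟨ cong (B +_) (cong₂ _+_ (length-replicate α) (length-replicate β)) ⟩
    B + (α + β)                                ∎)))
    where open ≡-Reasoning
... | C , a′ , b′ , lC , split with bumpedTail-split a′ b′
...   | a″ , b″ , tail = record
  -- The new prefix ends with the up step of the peak, so its length is `suc m`, the new bound; the
  -- down step opens the falls behind it.
  { prefix = prefix′ ++ true ∷ [] ; times = times ++ bumps b′ ∷ [] ; α = a″ ; β = b″
  ; length-prefix = trans (length-∷ʳ prefix′ true) (cong suc lA)
  ; length-w = trans (cong length (sym w′)) (trans (length-++ prefix′) (trans (+-suc (length prefix′) _)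
      (cong suc (trans (cong (length prefix′ +_) (length-bumpedTail a′ b′)) (trans (sym (length-++ prefix′)) (trans (cong length (sym w)) length-w))))))
  ; length-times = trans (length-∷ʳ times _) (cong suc length-times)
  ; tableaux = subst₂ (λ m w → Tableaux (extend m τ) (insertPeak m D) w (times ++ bumps b′ ∷ [])) lA w′
      (Tableaux-extend prefix′ a′ b′ (trans (length-perm bu) (sym length-times))
        (subst (λ u → Tableaux τ D u times) w tableaux))
  }
  where
  open Halves H
  prefix′ : Path
  prefix′ = prefix ++ C
  lA : length prefix′ ≡ m
  lA = trans (length-++ prefix) (trans (cong₂ _+_ length-prefix lC) (m+[n∸m]≡n B≤m))
  w : prefix ++ falls α ++ rises β ≡ prefix′ ++ falls a′ ++ rises b′
  w = trans (cong (prefix ++_) split) (sym (++-assoc prefix C _))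
  w′ : prefix′ ++ true ∷ bumpedTail a′ b′ ≡ (prefix′ ++ true ∷ []) ++ falls a″ ++ rises b″
  w′ = trans (cong (λ z → prefix′ ++ true ∷ z) tail) (sym (++-assoc prefix′ (true ∷ []) _))

-- Reading the path off the tableaux

from : ℕ → ℕ → List ℕ
from t zero    = []
from t (suc k) = t ∷ from (suc t) k

applyUpTo-from : ∀ (h : ℕ → ℕ) k → (∀ i → h i ≡ i + t) → applyUpTo h k ≡ from t k
applyUpTo-from h zero    e = refl
applyUpTo-from {t} h (suc k) e = cong₂ _∷_ (e 0) (applyUpTo-from (h ∘ suc) k λ i → trans (e (suc i)) (sym (+-suc i t)))

oneTo-from : ∀ n → oneTo n ≡ from 1 n
oneTo-from n = trans (map-applyUpTo (λ t → t) suc n) (applyUpTo-from suc n (λ i → +-comm 1 i))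

from-≥ : ∀ t k → All (t ≤_) (from t k)
from-≥ t zero    = []
from-≥ t (suc k) = ≤-refl ∷ All-map <⇒≤ (from-≥ (suc t) k)

∉ᵇ : ∀ {xs} → All (x <_) xs → (x ∈ᵇ xs) ≡ false
∉ᵇ [] = refl
∉ᵇ {x} {y ∷ xs} (x<y ∷ h) rewrite dec-false (x ≟ y) (<⇒≢ x<y) = ∉ᵇ h

∈ᵇ-places : ∀ t w → map (_∈ᵇ places true t w) (from t (length w)) ≡ w
∈ᵇ-places t [] = refl
∈ᵇ-places t (true ∷ w) rewrite dec-true (t ≟ t) refl = cong (true ∷_) (trans
  (map-cong-local (All-map (λ {x} t<x → skip x t<x) (from-≥ (suc t) (length w))))
  (∈ᵇ-places (suc t) w))
  where
  skip : ∀ x → t < x → (x ∈ᵇ (t ∷ places true (suc t) w)) ≡ (x ∈ᵇ places true (suc t) w)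
  skip x t<x rewrite dec-false (x ≟ t) (>⇒≢ t<x) = refl
∈ᵇ-places t (false ∷ w) = cong₂ _∷_ (∉ᵇ (places-≥ true (suc t) w)) (∈ᵇ-places (suc t) w)

∈ᵇ-places-oneTo : ∀ n w → length w ≡ n → map (_∈ᵇ places true 1 w) (oneTo n) ≡ w
∈ᵇ-places-oneTo n w refl = trans (cong (map (_∈ᵇ places true 1 w)) (oneTo-from n)) (∈ᵇ-places 1 w)

Ψ-path : Build n B τ D Ts → Ψ n τ ≡ D
Ψ-path {n} {τ = τ} {D} bu rewrite Tableaux.rsk (Halves.tableaux (halves bu)) = begin
  map (_∈ᵇ row 0 (insertionTableau w)) (oneTo n) ++ map (_∈ᵇ row 1 (recordingTableau times)) (reverse (oneTo n))
    ≡⟨ cong₂ (λ r s → map (_∈ᵇ r) (oneTo n) ++ map (_∈ᵇ s) (reverse (oneTo n)))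
         (row₀-twoRows (places true 1 w) (places false 1 w)) (row₁-twoRows (places false 1 times) (places true 1 times)) ⟩
  map (_∈ᵇ places true 1 w) (oneTo n) ++ map (_∈ᵇ places true 1 times) (reverse (oneTo n))
    ≡⟨ cong₂ _++_ (∈ᵇ-places-oneTo n w length-w)
         (trans (reverse-map _ (oneTo n)) (cong reverse (∈ᵇ-places-oneTo n times length-times))) ⟩
  w ++ reverse times
    ≡⟨ Tableaux.path tableaux ⟨
  D ∎
  where
  open Halves (halves bu)
  open ≡-Reasoning
  w : Path
  w = prefix ++ falls α ++ rises β

-- Every 321-avoiding permutation arises by growth

max-position : Build n B τ D Ts → 1 ≤ n → ∃[ i ] (i < n × nth 0 τ i ≡ n)
max-position (add {n = n} bu top) _ = n , ≤-refl , nth-extend-last′ bu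
max-position (add {n = n} {m = m} bu (low _ m<n)) _ with max-position bu (≤-trans (s≤s z≤n) m<n)
... | i , i<n , e = i , m<n⇒m<1+n i<n , trans (nth-extend-<′ bu i<n) (trans (cong (punch (suc m)) e) (punch-≥ m<n))

-- A positive `B` is the value of an entry with a larger one before it, so appending a value that
-- does not exceed `B` would complete a pattern 321. After a `low` step the larger entry is the old
-- maximum, which is raised because `m < n`.
bound-witness : Build n B τ D Ts → B ≡ 0 ⊎ ∃[ i ] ∃[ j ] (i < j × j < n × nth 0 τ j ≡ B × B < nth 0 τ i)
bound-witness nil = inj₁ refl
bound-witness (add {n = n} {B = B} {τ = τ} bu top) with bound-witness bu
... | inj₁ e = inj₁ e
... | inj₂ (i , j , i<j , j<n , e , h) = inj₂ (i , j , i<j , m<n⇒m<1+n j<n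
  , trans (nth-extend-<′ bu j<n) (trans (cong (punch (suc n)) e) fixB)
  , subst₂ _<_ fixB (sym (nth-extend-<′ bu (<-trans i<j j<n))) (punch-mono-< (suc n) h))
  where
  fixB : punch (suc n) B ≡ B
  fixB = punch-< (s≤s (Build-bound bu))
bound-witness (add {n = n} {m = m} bu (low _ m<n)) with max-position bu (≤-trans (s≤s z≤n) m<n)
... | i , i<n , e = inj₂ (i , n , i<n , ≤-refl , nth-extend-last′ bu
  , subst (suc m <_) (sym (trans (nth-extend-<′ bu i<n) (trans (cong (punch (suc m)) e) (punch-≥ m<n)))) (s≤s m<n))

upTo-punch : ∀ n → m ≤ n → upTo (suc n) ↭ m ∷ map (punch m) (upTo n)
upTo-punch {zero} n _ = ↭-reflexive (cong (0 ∷_) (sym (map-applyUpTo (λ t → t) suc n)))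
upTo-punch {suc m} (suc n) (s≤s m≤n) = ↭-trans
  (↭-reflexive (cong (0 ∷_) (sym (map-applyUpTo (λ t → t) suc (suc n)))))
  (↭-trans (↭-prep 0 (map⁺ suc (upTo-punch n m≤n)))
  (↭-trans (↭-swap 0 (suc m) ↭-refl)
  (↭-reflexive (cong (λ l → suc m ∷ 0 ∷ l) (begin
    map suc (map (punch m) (upTo n))           ≡⟨ map-∘ (upTo n) ⟨
    map (suc ∘ punch m) (upTo n)               ≡⟨ map-∘ (upTo n) ⟩
    map (punch (suc m)) (map suc (upTo n))     ≡⟨ cong (map (punch (suc m))) (map-applyUpTo (λ t → t) suc n) ⟩
    map (punch (suc m)) (applyUpTo suc n)      ∎)))))
  where open ≡-Reasoning

oneTo-punch : ∀ n → m ≤ n → oneTo (suc n) ↭ suc m ∷ map (punch (suc m)) (oneTo n)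
oneTo-punch {m} n m≤n = ↭-trans (map⁺ suc (upTo-punch n m≤n))
  (↭-reflexive (cong (suc m ∷_) (trans (sym (map-∘ (upTo n))) (map-∘ (upTo n)))))

-- The last value is some `suc m`. The other values are those of `oneTo (suc n)` without it, which
-- is the image of `punch (suc m)`, and so they can be pulled back along that map.
IsPerm-extend⁻ : ∀ n σ → IsPerm (suc n) σ → ∃[ m ] ∃[ τ ] (m ≤ n × IsPerm n τ × σ ≡ extend m τ)
IsPerm-extend⁻ n σ perm with initLast σ
... | [] with () ← ↭-length perm
... | ρ ∷ʳ′ v with ∈-map⁻ suc (∈-resp-↭ perm (∈-insert ρ))
...   | m , m∈ , refl with ↭-map-inv (punch (suc m)) (↭-sym (drop-mid ρ [] (↭-trans perm (oneTo-punch n (s≤s⁻¹ (∈-upTo⁻ m∈))))))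
...     | τ , e , τ↭ = m , τ , s≤s⁻¹ (∈-upTo⁻ m∈) , ↭-sym τ↭ , cong (_++ suc m ∷ []) (trans (sym (++-identityʳ ρ)) e)

Avoids321-extend⁻ : ∀ m τ → Avoids321 (extend m τ) → Avoids321 τ
Avoids321-extend⁻ m τ av i j k i<j j<k k<n (h , h′) =
  av i j k i<j j<k
    (≤-trans k<n (≤-trans (n≤1+n _) (≤-reflexive (sym (trans (length-∷ʳ (map (punch (suc m)) τ) (suc m)) (cong suc (length-map _ τ)))))))
    (lower (<-trans i<j (<-trans j<k k<n)) (<-trans j<k k<n) h , lower (<-trans j<k k<n) k<n h′)
  where
  lower : ∀ {x y} → x < length τ → y < length τ → nth 0 τ y < nth 0 τ x → nth 0 (extend m τ) y < nth 0 (extend m τ) x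
  lower x<n y<n r = subst₂ _<_ (sym (nth-extend-< τ y<n)) (sym (nth-extend-< τ x<n)) (punch-mono-< (suc m) r)

bound-≤ : Build n B τ D Ts → Avoids321 (extend m τ) → B ≤ m
bound-≤ {n} {B} {τ} {m = m} bu av with <-≤-connex m B | bound-witness bu
... | inj₂ B≤m | _         = B≤m
... | inj₁ m<B | inj₁ refl with () ← m<B
... | inj₁ m<B | inj₂ (i , j , i<j , j<n , e , h) = ⊥-elim (av i j n i<j j<n
  (≤-reflexive (sym (trans (length-∷ʳ (map (punch (suc m)) τ) (suc m)) (cong suc (trans (length-map _ τ) (length-perm bu))))))
  ( subst₂ _<_ (sym (nth-extend-<′ bu j<n)) (sym (nth-extend-<′ bu (<-trans i<j j<n))) (punch-mono-< (suc m) (subst (_< _) (sym e) h))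
  , subst₂ _<_ (sym (nth-extend-last′ bu)) (sym (trans (nth-extend-<′ bu j<n) (trans (cong (punch (suc m)) e) (punch-≥ m<B)))) (s≤s m<B)))

build : ∀ n σ → InS321 n σ → ∃[ B ] ∃[ D ] ∃[ Ts ] Build n B σ D Ts
build zero σ (perm , _) rewrite ↭-empty-inv perm = 0 , [] , [] , nil
build (suc n) σ (perm , av) with IsPerm-extend⁻ n σ perm
... | m , τ , m≤n , permτ , refl with build n τ (permτ , Avoids321-extend⁻ m τ av)
...   | B , D , Ts , bu with m≤n⇒m<n∨m≡n m≤n
...     | inj₁ m<n  = suc m , _ , _ , add bu (low (bound-≤ bu av) m<n)
...     | inj₂ refl = B , _ , _ , add bu top

theorem3p2 : (n : ℕ) → 1 ≤ n → (σ : List ℕ) → InS321 n σ →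
    crs n (Θ n σ) ≡ crs n σ
theorem3p2 n _ σ σ∈S with build n σ σ∈S
... | B , D , Ts , bu = begin
  crs n (Φinv n (Ψ n σ))         ≡⟨ cong (crs n ∘ Φinv n) (Ψ-path bu) ⟩
  crs n (Φinv n D)               ≡⟨ crs-Φinv bu ⟩
  ∑∈ Ts (crossingsInside n)      ≡⟨ ∑crossings≡∑-crossingsInside bu ⟨
  ∑crossings n (nth 0 σ)         ≡⟨ crs≡∑crossings n σ ⟨
  crs n σ                        ∎
  where open ≡-Reasoning
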